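{- Let $\Delta\ne0$ be an integer. There is a constant $c(\Delta)$, depending only on $\Delta$, such that for all real $X\ge1$ $$\sum_{\substack{r_1\ge1\\ (r_1,\Delta)=1}}\ \sum_{\substack{r_2\ge1\\ (r_2,\Delta)=1}}\ \sum_{\substack{d_1\ge1\\ q\mid d_1\Rightarrow q\mid\Delta}}\ \sum_{\substack{d_2\ge1\\ q\mid d_2\Rightarrow q\mid\Delta\\ [r_1^2d_1,r_2^2d_2]\ge X}}\frac{1}{[r_1^2d_1,r_2^2d_2]}\le c(\Delta)\,\frac{(\log X)^2+1}{\sqrt X}.$$
   Context: $r_1,r_2,d_1,d_2$ run over positive integers; $q$ denotes primes, so "$q\mid d\Rightarrow q\mid\Delta$" means every prime factor of $d$ divides $\Delta$. $(\cdot,\cdot)$ is the gcd and $[\cdot,\cdot]$ the lcm. -}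

module Defs where

open import Data.Integer.Base as ℤ using (ℤ; +_; 1ℤ; -[1+_])
import Data.Integer.Divisibility as ℤ
import Data.Integer.GCD as ℤ
import Data.Integer.Properties as ℤ
open import Data.List.Base using (List; map; foldr)
open import Data.List.Relation.Unary.All using (All)
open import Data.List.Relation.Unary.Unique.Propositional using (Unique)
open import Data.Nat.Base as ℕ using (ℕ; zero; suc)
import Data.Nat.Divisibility as ℕ
open import Data.Nat.LCM using (lcm)
open import Data.Nat.Primality using (Prime)
import Data.Nat.Properties as ℕ
open import Data.Product using (∃; _×_; _,_; proj₁; proj₂)
open import Data.Rational.Base
open import Data.Rational.Properties
import Data.Rational.Unnormalised.Base as ℚᵘ
import Data.Rational.Unnormalised.Properties as ℚᵘ
open import Data.Rational.Solver using (module +-*-Solver)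
open import Data.Sum using (inj₁; inj₂)
open import Relation.Binary.PropositionalEquality
open import Relation.Nullary using (yes; no; contradiction)

open +-*-Solver using (solve; _:=_; _:+_; _:*_; _:-_; :-_; con)

private variable
  b p q r s t ε δ : ℚ

≤⇒0≤- : p ≤ q → 0ℚ ≤ q - p
≤⇒0≤- {p} {q} p≤q = subst (_≤ q - p) (+-inverseʳ p) (+-monoˡ-≤ (- p) p≤q)

0≤-⇒≤ : 0ℚ ≤ q - p → p ≤ q
0≤-⇒≤ {q} {p} h = subst₂ _≤_ (+-identityˡ p) (solve 2 (λ q p → q :- p :+ p := q) refl q p) (+-monoˡ-≤ p h)

by : 0ℚ ≤ r → r ≡ q - p → p ≤ q
by h e = 0≤-⇒≤ (subst (0ℚ ≤_) e h)

0≤+ : 0ℚ ≤ p → 0ℚ ≤ q → 0ℚ ≤ p + q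
0≤+ {p} {q} h k = subst (_≤ p + q) (+-identityˡ 0ℚ) (+-mono-≤ h k)

0≤* : 0ℚ ≤ p → 0ℚ ≤ q → 0ℚ ≤ p * q
0≤* {p} {q} h k = nonNegative⁻¹ (p * q) {{nonNeg*nonNeg⇒nonNeg p {{nonNegative h}} q {{nonNegative k}}}}

0<* : 0ℚ < p → 0ℚ < q → 0ℚ < p * q
0<* {p} {q} h k = positive⁻¹ (p * q) {{pos*pos⇒pos p {{positive h}} q {{positive k}}}}

*-mono : 0ℚ ≤ p → p ≤ q → 0ℚ ≤ r → r ≤ s → p * r ≤ q * s
*-mono {p} {q} {r} {s} hp pq hr rs =
  by (0≤+ (0≤* (≤⇒0≤- pq) (≤-trans hr rs)) (0≤* hp (≤⇒0≤- rs)))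
     (solve 4 (λ p q r s → (q :- p) :* s :+ p :* (s :- r) := q :* s :- p :* r) refl p q r s)

0≤½ : 0ℚ ≤ ½
0≤½ = nonNegative⁻¹ ½

0<½ : 0ℚ < ½
0<½ = positive⁻¹ ½

0≤1 : 0ℚ ≤ 1ℚ
0≤1 = nonNegative⁻¹ 1ℚ

0<1 : 0ℚ < 1ℚ
0<1 = positive⁻¹ 1ℚ

½+½ : ∀ p → ½ * p + ½ * p ≡ p
½+½ = solve 1 (λ p → con ½ :* p :+ con ½ :* p := p) refl

p≤∣p∣ : ∀ p → p ≤ ∣ p ∣
p≤∣p∣ p with ≤-total 0ℚ p
... | inj₁ h = ≤-reflexive (sym (0≤p⇒∣p∣≡p h))
... | inj₂ h = ≤-trans h (0≤∣p∣ p)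

neg-sub : ∀ p q → - (p - q) ≡ q - p
neg-sub = solve 2 (λ p q → :- (p :- q) := q :- p) refl

∣∣≤ : ∀ p q → p - q ≤ ε → q - p ≤ ε → ∣ p - q ∣ ≤ ε
∣∣≤ {ε} p q h k with ∣p∣≡p∨∣p∣≡-p (p - q)
... | inj₁ e = subst (_≤ ε) (sym e) h
... | inj₂ e = subst (_≤ ε) (sym (trans e (neg-sub p q))) k

∣-∣-comm : ∀ p q → ∣ p - q ∣ ≡ ∣ q - p ∣
∣-∣-comm p q = trans (sym (∣-p∣≡∣p∣ (p - q))) (cong ∣_∣ (neg-sub p q))

∣-∣-trans : ∀ p q r → ∣ p - r ∣ ≤ ∣ p - q ∣ + ∣ q - r ∣
∣-∣-trans p q r = subst (λ w → ∣ w ∣ ≤ ∣ p - q ∣ + ∣ q - r ∣)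
  (solve 3 (λ p q r → (p :- q) :+ (q :- r) := p :- r) refl p q r) (∣p+q∣≤∣p∣+∣q∣ (p - q) (q - r))

∣∣≤⇒≤ : ∀ p q → ∣ p - q ∣ ≤ ε → p ≤ q + ε
∣∣≤⇒≤ {ε} p q h = by (≤⇒0≤- (≤-trans (p≤∣p∣ (p - q)) h))
  (solve 3 (λ p q e → e :- (p :- q) := q :+ e :- p) refl p q ε)

≤+⇒-≤ : ∀ p q → p ≤ q + ε → p - q ≤ ε
≤+⇒-≤ {ε} p q h = by (≤⇒0≤- h) (solve 3 (λ p q e → q :+ e :- p := e :- (p :- q)) refl p q ε)

⊔-lip : ∀ p q c → ∣ (p ⊔ c) - (q ⊔ c) ∣ ≤ ∣ p - q ∣
⊔-lip p q c = ∣∣≤ (p ⊔ c) (q ⊔ c) (half p q) (subst ((q ⊔ c) - (p ⊔ c) ≤_) (∣-∣-comm q p) (half q p))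
  where
  half : ∀ p q → (p ⊔ c) - (q ⊔ c) ≤ ∣ p - q ∣
  half p q = ≤+⇒-≤ (p ⊔ c) (q ⊔ c) (⊔-lub
    (≤-trans (∣∣≤⇒≤ p q ≤-refl) (+-monoˡ-≤ ∣ p - q ∣ (p≤p⊔q q c)))
    (≤-trans (p≤q⊔p q c) (subst (_≤ (q ⊔ c) + ∣ p - q ∣) (+-identityʳ (q ⊔ c))
      (+-monoʳ-≤ (q ⊔ c) (0≤∣p∣ (p - q))))))

*-diff : ∀ a b c d → ∣ a ∣ ≤ p → ∣ d ∣ ≤ q → ∣ b - d ∣ ≤ δ → ∣ a - c ∣ ≤ δ →
         ∣ a * b - c * d ∣ ≤ (p + q) * δ
*-diff {p} {q} {δ} a b c d ha hd hbd hac = begin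
  ∣ a * b - c * d ∣                 ≡⟨ cong ∣_∣ (solve 4 (λ a b c d → a :* b :- c :* d := a :* (b :- d) :+ d :* (a :- c)) refl a b c d) ⟩
  ∣ a * (b - d) + d * (a - c) ∣     ≤⟨ ∣p+q∣≤∣p∣+∣q∣ (a * (b - d)) (d * (a - c)) ⟩
  ∣ a * (b - d) ∣ + ∣ d * (a - c) ∣ ≡⟨ cong₂ _+_ (∣p*q∣≡∣p∣*∣q∣ a (b - d)) (∣p*q∣≡∣p∣*∣q∣ d (a - c)) ⟩
  ∣ a ∣ * ∣ b - d ∣ + ∣ d ∣ * ∣ a - c ∣ ≤⟨ +-mono-≤ (*-mono (0≤∣p∣ a) ha (0≤∣p∣ (b - d)) hbd) (*-mono (0≤∣p∣ d) hd (0≤∣p∣ (a - c)) hac) ⟩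
  p * δ + q * δ                     ≡⟨ sym (*-distribʳ-+ δ p q) ⟩
  (p + q) * δ                       ∎
  where open ≤-Reasoning

infix 9 _⁻¹

-- Total inverse, with 0 ⁻¹ = 0.
_⁻¹ : ℚ → ℚ
p ⁻¹ with p ≟ 0ℚ
... | yes _  = 0ℚ
... | no p≢0 = (1/ p) {{≢-nonZero p≢0}}

⁻¹-inverse : 0ℚ < p → p * p ⁻¹ ≡ 1ℚ
⁻¹-inverse {p} 0<p with p ≟ 0ℚ
... | yes refl = contradiction 0<p (<-irrefl refl)
... | no p≢0   = *-inverseʳ p {{≢-nonZero p≢0}}

0<⁻¹ : 0ℚ < p → 0ℚ < p ⁻¹
0<⁻¹ {p} 0<p with p ≟ 0ℚ
... | yes refl = contradiction 0<p (<-irrefl refl)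
... | no p≢0   = positive⁻¹ _ {{1/pos⇒pos p {{positive 0<p}}}}

0≤⁻¹ : 0ℚ < p → 0ℚ ≤ p ⁻¹
0≤⁻¹ h = <⇒≤ (0<⁻¹ h)

⁻¹-diff : 0ℚ < s → 0ℚ < t → s ⁻¹ - t ⁻¹ ≡ (t - s) * (s ⁻¹ * t ⁻¹)
⁻¹-diff {s} {t} hs ht = begin
  i - j                           ≡⟨ sym (cong₂ _-_ (*-identityʳ i) (*-identityʳ j)) ⟩
  i * 1ℚ - j * 1ℚ                 ≡⟨ sym (cong₂ (λ u v → i * u - j * v) (⁻¹-inverse ht) (⁻¹-inverse hs)) ⟩
  i * (t * j) - j * (s * i)       ≡⟨ solve 4 (λ s t i j → i :* (t :* j) :- j :* (s :* i) := (t :- s) :* (i :* j)) refl s t i j ⟩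
  (t - s) * (i * j)               ∎
  where
  open ≡-Reasoning
  i = s ⁻¹
  j = t ⁻¹

⁻¹-anti : 0ℚ < s → s ≤ t → t ⁻¹ ≤ s ⁻¹
⁻¹-anti hs st = by (0≤* (≤⇒0≤- st) (0≤* (0≤⁻¹ hs) (0≤⁻¹ ht))) (sym (⁻¹-diff hs ht))
  where ht = <-≤-trans hs st

⁻¹≤1 : 1ℚ ≤ t → t ⁻¹ ≤ 1ℚ
⁻¹≤1 = ⁻¹-anti 0<1

half^ : ℕ → ℚ
half^ zero    = 1ℚ
half^ (suc n) = ½ * half^ n

0≤half^ : ∀ n → 0ℚ ≤ half^ n
0≤half^ zero    = 0≤1
0≤half^ (suc n) = 0≤* 0≤½ (0≤half^ n)

half^-anti′ : ∀ m k → half^ (m ℕ.+ k) ≤ half^ m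
half^-anti′ (suc m) k = *-monoˡ-≤-nonNeg ½ (half^-anti′ m k)
half^-anti′ zero zero = ≤-refl
half^-anti′ zero (suc k) = ≤-trans
  (by (0≤* 0≤½ (0≤half^ k)) (solve 1 (λ h → con ½ :* h := h :- con ½ :* h) refl (half^ k)))
  (half^-anti′ zero k)

half^-anti : ∀ {m n} → m ℕ.≤ n → half^ n ≤ half^ m
half^-anti {m} m≤n = subst (λ n → half^ n ≤ half^ m) (ℕ.m+[n∸m]≡n m≤n) (half^-anti′ m _)

nat : ℕ → ℚ
nat zero    = 0ℚ
nat (suc n) = 1ℚ + nat n

half^*nat≤1 : ∀ n → half^ n * nat n ≤ 1ℚ
half^*nat≤1 zero    = 0≤1
half^*nat≤1 (suc n) = by
  (0≤+ (0≤* 0≤½ (≤⇒0≤- (half^*nat≤1 n))) (0≤* 0≤½ (≤⇒0≤- (half^-anti (ℕ.z≤n {n})))))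
  (solve 2 (λ h k → con ½ :* (con 1ℚ :- h :* k) :+ con ½ :* (con 1ℚ :- h)
                    := con 1ℚ :- con ½ :* h :* (con 1ℚ :+ k)) refl (half^ n) (nat n))

toℚᵘ-nat : ∀ n → toℚᵘ (nat n) ℚᵘ.≃ ℚᵘ.mkℚᵘ (+ n) 0
toℚᵘ-nat zero    = ℚᵘ.≃-refl
toℚᵘ-nat (suc n) = ℚᵘ.≃-trans (toℚᵘ-homo-+ 1ℚ (nat n))
  (ℚᵘ.≃-trans (ℚᵘ.+-congʳ (toℚᵘ 1ℚ) (toℚᵘ-nat n)) (ℚᵘ.*≡* (cong (λ k → (1ℤ ℤ.+ k) ℤ.* 1ℤ) (ℤ.*-identityʳ (+ n)))))

≤nat : ∀ q → q ≤ nat ℤ.∣ ↥ q ∣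
≤nat q@(mkℚ i d _) = toℚᵘ-cancel-≤ (ℚᵘ.≤-trans
  (ℚᵘ.*≤* (bound i)) (ℚᵘ.≤-reflexive (ℚᵘ.≃-sym (toℚᵘ-nat ℤ.∣ i ∣))))
  where
  bound : ∀ i → i ℤ.* 1ℤ ℤ.≤ + ℤ.∣ i ∣ ℤ.* + suc d
  bound (+ n)    = subst₂ ℤ._≤_ (sym (ℤ.*-identityʳ (+ n))) (ℤ.pos-* n (suc d)) (ℤ.+≤+ (ℕ.m≤m*n n (suc d)))
  bound -[1+ n ] = ℤ.-≤+

archimedes : ∀ B → 0ℚ < ε → ∃ λ N → ∀ n → N ℕ.≤ n → half^ n * B ≤ ε
archimedes {ε} B 0<ε = N , λ n N≤n → ≤-trans (≤-reflexive (expand n))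
    (≤-trans (*-monoʳ-≤-nonNeg ε {{nonNegative (<⇒≤ 0<ε)}} (small n N≤n)) (≤-reflexive (*-identityˡ ε)))
  where
  Q = B * ε ⁻¹
  N = ℤ.∣ ↥ Q ∣
  expand : ∀ n → half^ n * B ≡ half^ n * Q * ε
  expand n = sym (trans (solve 4 (λ h b e i → h :* (b :* i) :* e := h :* b :* (e :* i)) refl (half^ n) B ε (ε ⁻¹))
    (trans (cong (half^ n * B *_) (⁻¹-inverse 0<ε)) (*-identityʳ _)))
  0≤nat : ∀ n → 0ℚ ≤ nat n
  0≤nat zero    = ≤-refl
  0≤nat (suc n) = 0≤+ 0≤1 (0≤nat n)
  small : ∀ n → N ℕ.≤ n → half^ n * Q ≤ 1ℚ
  small n N≤n = ≤-trans (*-monoˡ-≤-nonNeg (half^ n) {{nonNegative (0≤half^ n)}} (≤nat Q))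
    (≤-trans (*-monoʳ-≤-nonNeg (nat N) {{nonNegative (0≤nat N)}} (half^-anti N≤n)) (half^*nat≤1 N))

shrink : 0ℚ ≤ b → 0ℚ < ε → ∃ λ δ → 0ℚ < δ × b * δ ≤ ε
shrink {b} {ε} 0≤b 0<ε = ε * (b + 1ℚ) ⁻¹ , 0<* 0<ε (0<⁻¹ 0<b+1) ,
  by (0≤* (<⇒≤ 0<ε) (0≤⁻¹ 0<b+1)) (begin
    ε * i                          ≡⟨ solve 3 (λ e i b → e :* i := e :* ((b :+ con 1ℚ) :* i) :- b :* (e :* i)) refl ε i b ⟩
    ε * ((b + 1ℚ) * i) - b * (ε * i) ≡⟨ cong (λ w → ε * w - b * (ε * i)) (⁻¹-inverse 0<b+1) ⟩
    ε * 1ℚ - b * (ε * i)           ≡⟨ cong (_- b * (ε * i)) (*-identityʳ ε) ⟩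
    ε - b * (ε * i)                ∎)
  where
  open ≡-Reasoning
  0<b+1 : 0ℚ < b + 1ℚ
  0<b+1 = <-≤-trans 0<1 (by 0≤b (solve 1 (λ b → b := b :+ con 1ℚ :- con 1ℚ) refl b))
  i = (b + 1ℚ) ⁻¹

0<half : 0ℚ < ε → 0ℚ < ½ * ε
0<half = 0<* 0<½

-- The seq of a real is any Cauchy sequence of rationals; reals are compared by
-- _≤ℝ_ and _≈ℝ_ below, never by _≡_.
record ℝ : Set where
  constructor mkℝ
  field
    seq    : ℕ → ℚ
    cauchy : ∀ ε → 0ℚ < ε →
             ∃ λ N → ∀ m n → N ℕ.≤ m → N ℕ.≤ n → ∣ seq m - seq n ∣ ≤ ε

open ℝ public

infix 4 _≤ℝ_ _≈ℝ_

_≤ℝ_ : ℝ → ℝ → Set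
x ≤ℝ y = ∀ ε → 0ℚ < ε → ∃ λ N → ∀ n → N ℕ.≤ n → seq x n ≤ seq y n + ε

_≈ℝ_ : ℝ → ℝ → Set
x ≈ℝ y = x ≤ℝ y × y ≤ℝ x

fromℚ : ℚ → ℝ
fromℚ q = mkℝ (λ _ → q) λ ε 0<ε → 0 , λ _ _ _ _ →
  subst (_≤ ε) (cong ∣_∣ (sym (+-inverseʳ q))) (<⇒≤ 0<ε)

0ℝ 1ℝ : ℝ
0ℝ = fromℚ 0ℚ
1ℝ = fromℚ 1ℚ

bounded : ∀ x → ∃ λ B → 0ℚ ≤ B × ∃ λ N → ∀ n → N ℕ.≤ n → ∣ seq x n ∣ ≤ B
bounded x with cauchy x 1ℚ 0<1
... | N , h = ∣ seq x N ∣ + 1ℚ , 0≤+ (0≤∣p∣ (seq x N)) 0≤1 , N , λ n N≤n →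
  subst (λ w → ∣ w ∣ ≤ ∣ seq x N ∣ + 1ℚ) (solve 2 (λ a b → a :+ (b :- a) := b) refl (seq x N) (seq x n))
    (≤-trans (∣p+q∣≤∣p∣+∣q∣ (seq x N) (seq x n - seq x N)) (+-monoʳ-≤ ∣ seq x N ∣ (h n N N≤n ℕ.≤-refl)))

infixl 6 _+ℝ_
infixl 7 _*ℝ_

_+ℝ_ : ℝ → ℝ → ℝ
x +ℝ y = mkℝ (λ n → seq x n + seq y n) prf
  where
  prf : ∀ ε → 0ℚ < ε → ∃ λ N → ∀ m n → N ℕ.≤ m → N ℕ.≤ n →
        ∣ (seq x m + seq y m) - (seq x n + seq y n) ∣ ≤ ε
  prf ε 0<ε with cauchy x (½ * ε) (0<half 0<ε) | cauchy y (½ * ε) (0<half 0<ε)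
  ... | N , h | M , k = N ℕ.⊔ M , λ m n m≥ n≥ → subst₂ _≤_
    (cong ∣_∣ (solve 4 (λ a b c d → (a :- c) :+ (b :- d) := (a :+ b) :- (c :+ d)) refl (seq x m) (seq y m) (seq x n) (seq y n)))
    (½+½ ε)
    (≤-trans (∣p+q∣≤∣p∣+∣q∣ (seq x m - seq x n) (seq y m - seq y n))
      (+-mono-≤ (h m n (ℕ.m⊔n≤o⇒m≤o N M m≥) (ℕ.m⊔n≤o⇒m≤o N M n≥))
                (k m n (ℕ.m⊔n≤o⇒n≤o N M m≥) (ℕ.m⊔n≤o⇒n≤o N M n≥))))

_*ℝ_ : ℝ → ℝ → ℝ
x *ℝ y = mkℝ (λ n → seq x n * seq y n) prf
  where
  prf : ∀ ε → 0ℚ < ε → ∃ λ N → ∀ m n → N ℕ.≤ m → N ℕ.≤ n →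
        ∣ seq x m * seq y m - seq x n * seq y n ∣ ≤ ε
  prf ε 0<ε =
    let B , 0≤B , N₁ , f = bounded x
        C , 0≤C , N₂ , g = bounded y
        δ , 0<δ , small  = shrink (0≤+ 0≤B 0≤C) 0<ε
        N₃ , h = cauchy x δ 0<δ
        N₄ , k = cauchy y δ 0<δ
    in N₁ ℕ.⊔ N₂ ℕ.⊔ (N₃ ℕ.⊔ N₄) , λ m n m≥ n≥ →
    let m₁₂ = ℕ.m⊔n≤o⇒m≤o (N₁ ℕ.⊔ N₂) _ m≥
        n₁₂ = ℕ.m⊔n≤o⇒m≤o (N₁ ℕ.⊔ N₂) _ n≥
        m₃₄ = ℕ.m⊔n≤o⇒n≤o (N₁ ℕ.⊔ N₂) (N₃ ℕ.⊔ N₄) m≥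
        n₃₄ = ℕ.m⊔n≤o⇒n≤o (N₁ ℕ.⊔ N₂) (N₃ ℕ.⊔ N₄) n≥
    in ≤-trans (*-diff {B} {C} {δ} (seq x m) (seq y m) (seq x n) (seq y n)
          (f m (ℕ.m⊔n≤o⇒m≤o N₁ N₂ m₁₂)) (g n (ℕ.m⊔n≤o⇒n≤o N₁ N₂ n₁₂))
          (k m n (ℕ.m⊔n≤o⇒n≤o N₃ N₄ m₃₄) (ℕ.m⊔n≤o⇒n≤o N₃ N₄ n₃₄))
          (h m n (ℕ.m⊔n≤o⇒m≤o N₃ N₄ m₃₄) (ℕ.m⊔n≤o⇒m≤o N₃ N₄ n₃₄))) small

Positiveℝ : ℝ → Set
Positiveℝ x = ∃ λ δ → 0ℚ < δ × fromℚ δ ≤ℝ x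

-- Since δ ≤ x, replacing seq x n by its maximum with δ does not change the limit.
inverse : (x : ℝ) → Positiveℝ x → ℝ
inverse x (δ , 0<δ , _) = mkℝ (λ n → (seq x n ⊔ δ) ⁻¹) prf
  where
  0<⊔ : ∀ q → 0ℚ < q ⊔ δ
  0<⊔ q = <-≤-trans 0<δ (p≤q⊔p q δ)
  C = δ ⁻¹ * δ ⁻¹
  0≤C : 0ℚ ≤ C
  0≤C = 0≤* (0≤⁻¹ 0<δ) (0≤⁻¹ 0<δ)
  lip : ∀ p q → (p ⊔ δ) ⁻¹ - (q ⊔ δ) ⁻¹ ≤ C * ∣ p - q ∣
  lip p q = ≤-trans (≤-reflexive (⁻¹-diff (0<⊔ p) (0<⊔ q))) (≤-trans
    (*-monoʳ-≤-nonNeg _ {{nonNegative (0≤* (0≤⁻¹ (0<⊔ p)) (0≤⁻¹ (0<⊔ q)))}}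
      (≤-trans (p≤∣p∣ ((q ⊔ δ) - (p ⊔ δ))) (subst (∣ (q ⊔ δ) - (p ⊔ δ) ∣ ≤_) (∣-∣-comm q p) (⊔-lip q p δ))))
    (≤-trans (*-monoˡ-≤-nonNeg ∣ p - q ∣ {{∣-∣-nonNeg (p - q)}}
      (*-mono (0≤⁻¹ (0<⊔ p)) (⁻¹-anti 0<δ (p≤q⊔p p δ)) (0≤⁻¹ (0<⊔ q)) (⁻¹-anti 0<δ (p≤q⊔p q δ))))
      (≤-reflexive (*-comm ∣ p - q ∣ C))))
  prf : ∀ ε → 0ℚ < ε → ∃ λ N → ∀ m n → N ℕ.≤ m → N ℕ.≤ n →
        ∣ (seq x m ⊔ δ) ⁻¹ - (seq x n ⊔ δ) ⁻¹ ∣ ≤ ε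
  prf ε 0<ε =
    let η , 0<η , small = shrink 0≤C 0<ε
        N , h = cauchy x η 0<η
        go : ∀ m n → N ℕ.≤ m → N ℕ.≤ n → (seq x m ⊔ δ) ⁻¹ - (seq x n ⊔ δ) ⁻¹ ≤ ε
        go m n m≥ n≥ = ≤-trans (lip (seq x m) (seq x n))
          (≤-trans (*-monoˡ-≤-nonNeg C {{nonNegative 0≤C}} (h m n m≥ n≥)) small)
    in N , λ m n m≥ n≥ → ∣∣≤ ((seq x m ⊔ δ) ⁻¹) ((seq x n ⊔ δ) ⁻¹) (go m n m≥ n≥) (go n m n≥ m≥)

_÷ℝ_[_] : (x y : ℝ) → Positiveℝ y → ℝ
x ÷ℝ y [ y>0 ] = x *ℝ inverse y y>0

-- The left end point after n bisections of [lo , hi] in the search for √q.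
bisect : ℚ → ℕ → ℚ → ℚ → ℚ
bisect q zero    lo hi = lo
bisect q (suc n) lo hi with (½ * (lo + hi)) * (½ * (lo + hi)) ≤? q
... | yes _ = bisect q n (½ * (lo + hi)) hi
... | no  _ = bisect q n lo (½ * (lo + hi))

sqrtApprox : ℕ → ℚ → ℚ
sqrtApprox n q = bisect q n 0ℚ (q + 1ℚ)

lo≤mid : ∀ a b → a ≤ b → a ≤ ½ * (a + b)
lo≤mid a b h = by (0≤* 0≤½ (≤⇒0≤- h)) (solve 2 (λ a b → con ½ :* (b :- a) := con ½ :* (a :+ b) :- a) refl a b)

mid≤hi : ∀ a b → a ≤ b → ½ * (a + b) ≤ b
mid≤hi a b h = by (0≤* 0≤½ (≤⇒0≤- h)) (solve 2 (λ a b → con ½ :* (b :- a) := b :- con ½ :* (a :+ b)) refl a b)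

bisect-spec : ∀ q n lo hi → lo ≤ hi → lo * lo ≤ q → q < hi * hi →
  lo ≤ bisect q n lo hi ×
  bisect q n lo hi * bisect q n lo hi ≤ q ×
  q < (bisect q n lo hi + half^ n * (hi - lo)) * (bisect q n lo hi + half^ n * (hi - lo))
bisect-spec q zero lo hi h l u = ≤-refl , l , subst (λ w → q < w * w)
  (solve 2 (λ a b → b := a :+ con 1ℚ :* (b :- a)) refl lo hi) u
bisect-spec q (suc n) lo hi h l u with (½ * (lo + hi)) * (½ * (lo + hi)) ≤? q
... | yes m≤ = let f , g , k = bisect-spec q n (½ * (lo + hi)) hi (mid≤hi lo hi h) m≤ u in
  ≤-trans (lo≤mid lo hi h) f , g , subst (λ w → q < (bisect q n (½ * (lo + hi)) hi + w) * (bisect q n (½ * (lo + hi)) hi + w))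
    (solve 3 (λ e a b → e :* (b :- con ½ :* (a :+ b)) := con ½ :* e :* (b :- a)) refl (half^ n) lo hi) k
... | no m≰ = let f , g , k = bisect-spec q n lo (½ * (lo + hi)) (lo≤mid lo hi h) l (≰⇒> m≰) in
  f , g , subst (λ w → q < (bisect q n lo (½ * (lo + hi)) + w) * (bisect q n lo (½ * (lo + hi)) + w))
    (solve 3 (λ e a b → e :* (con ½ :* (a :+ b) :- a) := con ½ :* e :* (b :- a)) refl (half^ n) lo hi) k

sqrtApprox-spec : ∀ n q → 0ℚ ≤ q →
  0ℚ ≤ sqrtApprox n q ×
  sqrtApprox n q * sqrtApprox n q ≤ q ×
  q < (sqrtApprox n q + half^ n * (q + 1ℚ)) * (sqrtApprox n q + half^ n * (q + 1ℚ))
sqrtApprox-spec n q 0≤q = let f , g , k = bisect-spec q n 0ℚ (q + 1ℚ) (0≤+ 0≤q 0≤1) 0≤q q< in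
  f , g , subst (λ w → q < (sqrtApprox n q + half^ n * w) * (sqrtApprox n q + half^ n * w)) (+-identityʳ (q + 1ℚ)) k
  where
  q< : q < (q + 1ℚ) * (q + 1ℚ)
  q< = <-≤-trans (subst (_< q + 1ℚ) (+-identityʳ q) (+-monoʳ-< q 0<1))
    (by (0≤* 0≤q (0≤+ 0≤q 0≤1)) (solve 1 (λ q → q :* (q :+ con 1ℚ) := (q :+ con 1ℚ) :* (q :+ con 1ℚ) :- (q :+ con 1ℚ)) refl q))

sqrt-compare : ∀ s t w y z → 0ℚ ≤ s → 0ℚ ≤ w → 0ℚ < ε → w ≤ ½ * ε →
  y < (s + w) * (s + w) → t * t ≤ z → z ≤ y + (½ * ε) * (½ * ε) → t ≤ s + ε
sqrt-compare {ε} s t w y z 0≤s 0≤w 0<ε w≤ y< t≤ z≤ with t ≤? s + ε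
... | yes t≤s+ε = t≤s+ε
... | no  t≰s+ε = contradiction chain (<-irrefl refl)
  where
  e = ½ * ε
  0≤e : 0ℚ ≤ e
  0≤e = <⇒≤ (0<half 0<ε)
  v≤t : s + w + e ≤ t
  v≤t = ≤-trans (by (≤⇒0≤- w≤) (solve 3 (λ s w e → con ½ :* e :- w := s :+ e :- (s :+ w :+ con ½ :* e)) refl s w ε)) (<⇒≤ (≰⇒> t≰s+ε))
  0≤s+w = 0≤+ 0≤s 0≤w
  chain : t * t < t * t
  chain = ≤-<-trans t≤ (≤-<-trans z≤ (<-≤-trans (+-monoˡ-< (e * e) y<) (≤-trans
    (by (0≤+ (0≤* 0≤s+w 0≤e) (0≤* 0≤s+w 0≤e))
      (solve 2 (λ v e → v :* e :+ v :* e := (v :+ e) :* (v :+ e) :- (v :* v :+ e :* e)) refl (s + w) e))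
    (*-mono (0≤+ 0≤s+w 0≤e) v≤t (0≤+ 0≤s+w 0≤e) v≤t))))

width : ∀ x c → 0ℚ < δ → ∃ λ N → ∀ n → N ℕ.≤ n → half^ n * ((seq x n ⊔ c) + 1ℚ) ≤ δ
width {δ} x c 0<δ =
  let B , 0≤B , N , f = bounded x
      M , g = archimedes ((B ⊔ c) + 1ℚ) 0<δ
  in N ℕ.⊔ M , λ n n≥ → ≤-trans
    (*-monoˡ-≤-nonNeg (half^ n) {{nonNegative (0≤half^ n)}} (+-monoˡ-≤ 1ℚ
      (⊔-mono-≤ (≤-trans (p≤∣p∣ (seq x n)) (f n (ℕ.m⊔n≤o⇒m≤o N M n≥))) (≤-refl {c}))))
    (g n (ℕ.m⊔n≤o⇒n≤o N M n≥))

0≤width : ∀ n q → 0ℚ ≤ half^ n * ((q ⊔ 0ℚ) + 1ℚ)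
0≤width n q = 0≤* (0≤half^ n) (0≤+ (p≤q⊔p q 0ℚ) 0≤1)

-- Since 0 ≤ x, replacing seq x n by its maximum with 0 does not change the limit.
sqrt : (x : ℝ) → 0ℝ ≤ℝ x → ℝ
sqrt x _ = mkℝ root prf
  where
  root : ℕ → ℚ
  root n = sqrtApprox n (seq x n ⊔ 0ℚ)
  prf : ∀ ε → 0ℚ < ε → ∃ λ N → ∀ m n → N ℕ.≤ m → N ℕ.≤ n → ∣ root m - root n ∣ ≤ ε
  prf ε 0<ε =
    let N , h = cauchy x ((½ * ε) * (½ * ε)) (0<* (0<half 0<ε) (0<half 0<ε))
        M , w = width x 0ℚ (0<half 0<ε)
        go : ∀ m n → N ℕ.⊔ M ℕ.≤ m → N ℕ.⊔ M ℕ.≤ n → root m - root n ≤ ε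
        go m n m≥ n≥ =
          let y = seq x n ⊔ 0ℚ
              z = seq x m ⊔ 0ℚ
              _ , sq≤ , _     = sqrtApprox-spec m z (p≤q⊔p (seq x m) 0ℚ)
              0≤s , _ , <sq   = sqrtApprox-spec n y (p≤q⊔p (seq x n) 0ℚ)
          in ≤+⇒-≤ (root m) (root n) (sqrt-compare (root n) (root m) (half^ n * (y + 1ℚ)) y z 0≤s
               (0≤width n (seq x n)) 0<ε (w n (ℕ.m⊔n≤o⇒n≤o N M n≥)) <sq sq≤
               (∣∣≤⇒≤ z y (≤-trans (⊔-lip (seq x m) (seq x n) 0ℚ)
                 (h m n (ℕ.m⊔n≤o⇒m≤o N M m≥) (ℕ.m⊔n≤o⇒m≤o N M n≥)))))
    in N ℕ.⊔ M , λ m n m≥ n≥ → ∣∣≤ (root m) (root n) (go m n m≥ n≥) (go n m n≥ m≥)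

sqrt-nonNeg : ∀ x 0≤x → 0ℝ ≤ℝ sqrt x 0≤x
sqrt-nonNeg x _ ε 0<ε = 0 , λ n _ →
  0≤+ (proj₁ (sqrtApprox-spec n (seq x n ⊔ 0ℚ) (p≤q⊔p (seq x n) 0ℚ))) (<⇒≤ 0<ε)

sqrt-square : ∀ x 0≤x → sqrt x 0≤x *ℝ sqrt x 0≤x ≈ℝ x
sqrt-square x 0≤x = upper , lower
  where
  root : ℕ → ℚ
  root n = sqrtApprox n (seq x n ⊔ 0ℚ)
  spec : ∀ n → _
  spec n = sqrtApprox-spec n (seq x n ⊔ 0ℚ) (p≤q⊔p (seq x n) 0ℚ)
  upper : sqrt x 0≤x *ℝ sqrt x 0≤x ≤ℝ x
  upper ε 0<ε = let N , h = 0≤x ε 0<ε in N , λ n n≥ →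
    ≤-trans (proj₁ (proj₂ (spec n))) (⊔-lub
      (subst (_≤ seq x n + ε) (+-identityʳ (seq x n)) (+-monoʳ-≤ (seq x n) (<⇒≤ 0<ε))) (h n n≥))
  root≤ : ∀ s y → 0ℚ ≤ s → 0ℚ ≤ y → s * s ≤ y → s ≤ y + 1ℚ
  root≤ s y 0≤s 0≤y sq≤ with ≤-total s 1ℚ
  ... | inj₁ s≤1 = ≤-trans s≤1 (by 0≤y (solve 1 (λ y → y := y :+ con 1ℚ :- con 1ℚ) refl y))
  ... | inj₂ 1≤s = ≤-trans (by (0≤* 0≤s (≤⇒0≤- 1≤s)) (solve 1 (λ s → s :* (s :- con 1ℚ) := s :* s :- s) refl s))
    (≤-trans sq≤ (by 0≤1 (solve 1 (λ y → con 1ℚ := y :+ con 1ℚ :- y) refl y)))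
  expand : ∀ s w b → 0ℚ ≤ s → s ≤ b → 0ℚ ≤ w → w ≤ 1ℚ →
           (s + w) * (s + w) ≤ s * s + (b + b + 1ℚ) * w
  expand s w b 0≤s s≤b 0≤w w≤1 = by
    (0≤* (0≤+ (0≤+ (≤⇒0≤- s≤b) (≤⇒0≤- s≤b)) (≤⇒0≤- w≤1)) 0≤w)
    (solve 3 (λ s w b → ((b :- s) :+ (b :- s) :+ (con 1ℚ :- w)) :* w
       := s :* s :+ (b :+ b :+ con 1ℚ) :* w :- (s :+ w) :* (s :+ w)) refl s w b)
  lower : x ≤ℝ sqrt x 0≤x *ℝ sqrt x 0≤x
  lower ε 0<ε =
    let B , 0≤B , N , f = bounded x
        b   = (B ⊔ 0ℚ) + 1ℚ
        0≤b = 0≤+ (p≤q⊔p B 0ℚ) 0≤1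
        0≤k = 0≤+ (0≤+ 0≤b 0≤b) 0≤1
        δ , 0<δ , small = shrink 0≤k 0<ε
        M , w = width x 0ℚ 0<δ
        L , v = width x 0ℚ 0<1
    in N ℕ.⊔ (M ℕ.⊔ L) , λ n n≥ →
      let N≤n = ℕ.m⊔n≤o⇒m≤o N _ n≥
          ML≤n = ℕ.m⊔n≤o⇒n≤o N (M ℕ.⊔ L) n≥
          y = seq x n ⊔ 0ℚ
          0≤s , sq≤ , <sq = spec n
      in ≤-trans (p≤p⊔q (seq x n) 0ℚ) (≤-trans (<⇒≤ <sq) (≤-trans
        (expand (root n) (half^ n * (y + 1ℚ)) b 0≤s
          (≤-trans (root≤ (root n) y 0≤s (p≤q⊔p (seq x n) 0ℚ) sq≤)
            (+-monoˡ-≤ 1ℚ (⊔-mono-≤ (≤-trans (p≤∣p∣ (seq x n)) (f n N≤n)) (≤-refl {0ℚ}))))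
          (0≤width n (seq x n)) (v n (ℕ.m⊔n≤o⇒n≤o M L ML≤n)))
        (+-monoʳ-≤ (root n * root n) (≤-trans
          (*-monoˡ-≤-nonNeg (b + b + 1ℚ) {{nonNegative 0≤k}} (w n (ℕ.m⊔n≤o⇒m≤o M L ML≤n))) small))))

1≤⇒0≤ : ∀ x → 1ℝ ≤ℝ x → 0ℝ ≤ℝ x
1≤⇒0≤ x 1≤x ε 0<ε = let N , h = 1≤x ε 0<ε in N , λ n n≥ → ≤-trans 0≤1 (h n n≥)

1≤⇒sqrt-positive : ∀ x 1≤x → Positiveℝ (sqrt x (1≤⇒0≤ x 1≤x))
1≤⇒sqrt-positive x 1≤x = 1ℚ , 0<1 , λ ε 0<ε →
  let N , h = 1≤x ((½ * ε) * (½ * ε)) (0<* (0<half 0<ε) (0<half 0<ε))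
      M , w = width x 0ℚ (0<half 0<ε)
  in N ℕ.⊔ M , λ n n≥ →
    let y = seq x n ⊔ 0ℚ
        0≤s , _ , <sq = sqrtApprox-spec n y (p≤q⊔p (seq x n) 0ℚ)
    in sqrt-compare (sqrtApprox n y) 1ℚ (half^ n * (y + 1ℚ)) y 1ℚ 0≤s (0≤width n (seq x n)) 0<ε
         (w n (ℕ.m⊔n≤o⇒n≤o N M n≥)) <sq ≤-refl
         (≤-trans (h n (ℕ.m⊔n≤o⇒m≤o N M n≥)) (+-monoˡ-≤ _ (p≤p⊔q (seq x n) 0ℚ)))

-- Riemann sum of f over [a , b], at left end points, on 2ⁿ subintervals of equal length.
riemannSum : (ℚ → ℚ) → ℕ → ℚ → ℚ → ℚ
riemannSum f zero    a b = (b - a) * f a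
riemannSum f (suc n) a b = riemannSum f n a (½ * (a + b)) + riemannSum f n (½ * (a + b)) b

riemannSum-affine : ∀ f y n a b →
  riemannSum f n (1ℚ + a * y) (1ℚ + b * y) ≡ riemannSum (λ t → y * f (1ℚ + t * y)) n a b
riemannSum-affine f y zero a b =
  solve 4 (λ a b y v → (con 1ℚ :+ b :* y :- (con 1ℚ :+ a :* y)) :* v := (b :- a) :* (y :* v)) refl a b y (f (1ℚ + a * y))
riemannSum-affine f y (suc n) a b = begin
  riemannSum f n a′ (½ * (a′ + b′)) + riemannSum f n (½ * (a′ + b′)) b′
    ≡⟨ cong (λ w → riemannSum f n a′ w + riemannSum f n w b′)
         (solve 3 (λ a b y → con ½ :* (con 1ℚ :+ a :* y :+ (con 1ℚ :+ b :* y)) := con 1ℚ :+ con ½ :* (a :+ b) :* y) refl a b y) ⟩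
  riemannSum f n a′ m′ + riemannSum f n m′ b′
    ≡⟨ cong₂ _+_ (riemannSum-affine f y n a (½ * (a + b))) (riemannSum-affine f y n (½ * (a + b)) b) ⟩
  riemannSum (λ t → y * f (1ℚ + t * y)) (suc n) a b ∎
  where
  open ≡-Reasoning
  a′ = 1ℚ + a * y
  b′ = 1ℚ + b * y
  m′ = 1ℚ + ½ * (a + b) * y

riemannSum-mono : ∀ f g c n a b → 0ℚ ≤ a → a ≤ b → (∀ t → 0ℚ ≤ t → f t ≤ g t + c) →
  riemannSum f n a b ≤ riemannSum g n a b + (b - a) * c
riemannSum-mono f g c zero a b 0≤a a≤b h = ≤-trans
  (*-monoˡ-≤-nonNeg (b - a) {{nonNegative (≤⇒0≤- a≤b)}} (h a 0≤a))
  (≤-reflexive (*-distribˡ-+ (b - a) (g a) c))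
riemannSum-mono f g c (suc n) a b 0≤a a≤b h = ≤-trans
  (+-mono-≤ (riemannSum-mono f g c n a m 0≤a (lo≤mid a b a≤b) h)
            (riemannSum-mono f g c n m b (≤-trans 0≤a (lo≤mid a b a≤b)) (mid≤hi a b a≤b) h))
  (≤-reflexive (solve 6 (λ u v a b m c → u :+ (m :- a) :* c :+ (v :+ (b :- m) :* c) := u :+ v :+ (b :- a) :* c) refl
    (riemannSum g n a m) (riemannSum g n m b) a b m c))
  where m = ½ * (a + b)

riemannSum-⁻¹-upper : ∀ n a b → 1ℚ ≤ a → a ≤ b → riemannSum _⁻¹ n a b ≤ (b - a) * a ⁻¹
riemannSum-⁻¹-upper zero    a b 1≤a a≤b = ≤-refl
riemannSum-⁻¹-upper (suc n) a b 1≤a a≤b = ≤-trans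
  (+-mono-≤ (riemannSum-⁻¹-upper n a m 1≤a (lo≤mid a b a≤b)) (≤-trans
    (riemannSum-⁻¹-upper n m b (≤-trans 1≤a (lo≤mid a b a≤b)) (mid≤hi a b a≤b))
    (*-monoˡ-≤-nonNeg (b - m) {{nonNegative (≤⇒0≤- (mid≤hi a b a≤b))}} (⁻¹-anti (<-≤-trans 0<1 1≤a) (lo≤mid a b a≤b)))))
  (≤-reflexive (solve 4 (λ a b m v → (m :- a) :* v :+ (b :- m) :* v := (b :- a) :* v) refl a b m (a ⁻¹)))
  where m = ½ * (a + b)

riemannSum-⁻¹-lower : ∀ n a b → 1ℚ ≤ a → a ≤ b → (b - a) * b ⁻¹ ≤ riemannSum _⁻¹ n a b
riemannSum-⁻¹-lower zero a b 1≤a a≤b =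
  *-monoˡ-≤-nonNeg (b - a) {{nonNegative (≤⇒0≤- a≤b)}} (⁻¹-anti (<-≤-trans 0<1 1≤a) a≤b)
riemannSum-⁻¹-lower (suc n) a b 1≤a a≤b = ≤-trans
  (≤-reflexive (solve 4 (λ a b m v → (b :- a) :* v := (m :- a) :* v :+ (b :- m) :* v) refl a b m (b ⁻¹)))
  (+-mono-≤ (≤-trans
    (*-monoˡ-≤-nonNeg (m - a) {{nonNegative (≤⇒0≤- a≤m)}} (⁻¹-anti (<-≤-trans 0<1 1≤m) (mid≤hi a b a≤b)))
    (riemannSum-⁻¹-lower n a m 1≤a a≤m))
    (riemannSum-⁻¹-lower n m b 1≤m (mid≤hi a b a≤b)))
  where
  m = ½ * (a + b)
  a≤m = lo≤mid a b a≤b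
  1≤m = ≤-trans 1≤a a≤m

riemannSum-⁻¹-anti : ∀ n k a b → 1ℚ ≤ a → a ≤ b → riemannSum _⁻¹ (n ℕ.+ k) a b ≤ riemannSum _⁻¹ n a b
riemannSum-⁻¹-anti zero    k a b 1≤a a≤b = riemannSum-⁻¹-upper k a b 1≤a a≤b
riemannSum-⁻¹-anti (suc n) k a b 1≤a a≤b = +-mono-≤
  (riemannSum-⁻¹-anti n k a m 1≤a a≤m)
  (riemannSum-⁻¹-anti n k m b (≤-trans 1≤a a≤m) (mid≤hi a b a≤b))
  where
  m = ½ * (a + b)
  a≤m = lo≤mid a b a≤b

riemannSum-⁻¹-gap : ∀ n k a b → 1ℚ ≤ a → a ≤ b →
  riemannSum _⁻¹ n a b ≤ riemannSum _⁻¹ (n ℕ.+ k) a b + half^ n * (b - a) * (a ⁻¹ - b ⁻¹)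
riemannSum-⁻¹-gap zero k a b 1≤a a≤b = by (≤⇒0≤- (riemannSum-⁻¹-lower k a b 1≤a a≤b))
  (solve 4 (λ w r u v → r :- w :* v := r :+ con 1ℚ :* w :* (u :- v) :- w :* u) refl
    (b - a) (riemannSum _⁻¹ k a b) (a ⁻¹) (b ⁻¹))
riemannSum-⁻¹-gap (suc n) k a b 1≤a a≤b = ≤-trans
  (+-mono-≤ (riemannSum-⁻¹-gap n k a m 1≤a a≤m) (riemannSum-⁻¹-gap n k m b (≤-trans 1≤a a≤m) (mid≤hi a b a≤b)))
  (≤-reflexive (solve 8 (λ r s h a b u w v →
      r :+ h :* (con ½ :* (a :+ b) :- a) :* (u :- w) :+ (s :+ h :* (b :- con ½ :* (a :+ b)) :* (w :- v))
      := r :+ s :+ con ½ :* h :* (b :- a) :* (u :- v)) refl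
    (riemannSum _⁻¹ (n ℕ.+ k) a m) (riemannSum _⁻¹ (n ℕ.+ k) m b) (half^ n) a b (a ⁻¹) (m ⁻¹) (b ⁻¹)))
  where
  m = ½ * (a + b)
  a≤m = lo≤mid a b a≤b

logApprox : ℕ → ℚ → ℚ
logApprox n q = riemannSum _⁻¹ n 1ℚ q

logApprox-refine : ∀ N m n q → 1ℚ ≤ q → N ℕ.≤ m → N ℕ.≤ n →
  logApprox m q ≤ logApprox n q + half^ N * (q + 1ℚ)
logApprox-refine N m n q 1≤q N≤m N≤n = begin
  logApprox m q                               ≡⟨ cong (λ k → logApprox k q) (sym (ℕ.m+[n∸m]≡n N≤m)) ⟩
  logApprox (N ℕ.+ (m ℕ.∸ N)) q               ≤⟨ riemannSum-⁻¹-anti N (m ℕ.∸ N) 1ℚ q ≤-refl 1≤q ⟩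
  logApprox N q                               ≤⟨ riemannSum-⁻¹-gap N (n ℕ.∸ N) 1ℚ q ≤-refl 1≤q ⟩
  logApprox (N ℕ.+ (n ℕ.∸ N)) q + half^ N * (q - 1ℚ) * (1ℚ - q ⁻¹)
                                              ≡⟨ cong (λ k → logApprox k q + half^ N * (q - 1ℚ) * (1ℚ - q ⁻¹)) (ℕ.m+[n∸m]≡n N≤n) ⟩
  logApprox n q + half^ N * (q - 1ℚ) * (1ℚ - q ⁻¹)
                                              ≤⟨ +-monoʳ-≤ (logApprox n q) (by
                                                   (0≤* (0≤half^ N) (0≤+ (0≤* (≤⇒0≤- 1≤q) (0≤⁻¹ (<-≤-trans 0<1 1≤q))) (0≤+ 0≤1 0≤1)))
                                                   (solve 3 (λ h q v → h :* ((q :- con 1ℚ) :* v :+ (con 1ℚ :+ con 1ℚ))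
                                                      := h :* (q :+ con 1ℚ) :- h :* (q :- con 1ℚ) :* (con 1ℚ :- v)) refl (half^ N) q (q ⁻¹))) ⟩
  logApprox n q + half^ N * (q + 1ℚ)          ∎
  where open ≤-Reasoning

integrand-lip : ∀ y z t → 0ℚ ≤ y → 0ℚ ≤ z → 0ℚ ≤ t →
  y * (1ℚ + t * y) ⁻¹ ≤ z * (1ℚ + t * z) ⁻¹ + ∣ y - z ∣
integrand-lip y z t 0≤y 0≤z 0≤t = ≤-trans (≤-reflexive eq) (+-monoʳ-≤ (z * k) (≤-trans
    (*-monoʳ-≤-nonNeg (i * k) {{nonNegative 0≤ik}} (p≤∣p∣ (y - z)))
    (≤-trans (*-monoˡ-≤-nonNeg ∣ y - z ∣ {{∣-∣-nonNeg (y - z)}} ik≤1) (≤-reflexive (*-identityʳ ∣ y - z ∣)))))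
  where
  i = (1ℚ + t * y) ⁻¹
  k = (1ℚ + t * z) ⁻¹
  1≤ : ∀ w → 0ℚ ≤ w → 1ℚ ≤ 1ℚ + t * w
  1≤ w 0≤w = by (0≤* 0≤t 0≤w) (solve 1 (λ v → v := con 1ℚ :+ v :- con 1ℚ) refl (t * w))
  0<y′ = <-≤-trans 0<1 (1≤ y 0≤y)
  0<z′ = <-≤-trans 0<1 (1≤ z 0≤z)
  0≤ik : 0ℚ ≤ i * k
  0≤ik = 0≤* (0≤⁻¹ 0<y′) (0≤⁻¹ 0<z′)
  ik≤1 : i * k ≤ 1ℚ
  ik≤1 = *-mono (0≤⁻¹ 0<y′) (⁻¹≤1 (1≤ y 0≤y)) (0≤⁻¹ 0<z′) (⁻¹≤1 (1≤ z 0≤z))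
  eq : y * i ≡ z * k + (y - z) * (i * k)
  eq = begin
    y * i                                                     ≡⟨ solve 3 (λ y i v → y :* i := y :* i :* con 1ℚ) refl y i k ⟩
    y * i * 1ℚ                                                ≡⟨ cong (y * i *_) (sym (⁻¹-inverse 0<z′)) ⟩
    y * i * ((1ℚ + t * z) * k)                                ≡⟨ solve 5 (λ y z t i k → y :* i :* ((con 1ℚ :+ t :* z) :* k)
                                                                   := z :* k :* ((con 1ℚ :+ t :* y) :* i) :+ (y :- z) :* (i :* k)) refl y z t i k ⟩
    z * k * ((1ℚ + t * y) * i) + (y - z) * (i * k)            ≡⟨ cong (λ w → z * k * w + (y - z) * (i * k)) (⁻¹-inverse 0<y′) ⟩
    z * k * 1ℚ + (y - z) * (i * k)                            ≡⟨ cong (_+ (y - z) * (i * k)) (*-identityʳ (z * k)) ⟩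
    z * k + (y - z) * (i * k)                                 ∎
    where open ≡-Reasoning

logApprox-lip : ∀ n p q → 1ℚ ≤ p → 1ℚ ≤ q → logApprox n p ≤ logApprox n q + ∣ p - q ∣
logApprox-lip n p q 1≤p 1≤q = begin
  logApprox n p                 ≡⟨ substitute p ⟩
  riemannSum (F p) n 0ℚ 1ℚ      ≤⟨ riemannSum-mono (F p) (F q) ∣ p - q ∣ n 0ℚ 1ℚ ≤-refl 0≤1 lip ⟩
  riemannSum (F q) n 0ℚ 1ℚ + (1ℚ - 0ℚ) * ∣ p - q ∣
                                ≡⟨ cong₂ _+_ (sym (substitute q)) (*-identityˡ ∣ p - q ∣) ⟩
  logApprox n q + ∣ p - q ∣     ∎
  where
  open ≤-Reasoning
  F : ℚ → ℚ → ℚ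
  F x t = (x - 1ℚ) * (1ℚ + t * (x - 1ℚ)) ⁻¹
  lip : ∀ t → 0ℚ ≤ t → F p t ≤ F q t + ∣ p - q ∣
  lip t 0≤t = subst (λ w → F p t ≤ F q t + ∣ w ∣)
    (solve 2 (λ p q → p :- con 1ℚ :- (q :- con 1ℚ) := p :- q) refl p q)
    (integrand-lip (p - 1ℚ) (q - 1ℚ) t (≤⇒0≤- 1≤p) (≤⇒0≤- 1≤q) 0≤t)
  substitute : ∀ x → logApprox n x ≡ riemannSum (F x) n 0ℚ 1ℚ
  substitute x = trans
    (cong₂ (riemannSum _⁻¹ n)
      (solve 1 (λ y → con 1ℚ := con 1ℚ :+ con 0ℚ :* y) refl (x - 1ℚ))
      (solve 1 (λ x → x := con 1ℚ :+ con 1ℚ :* (x :- con 1ℚ)) refl x))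
    (riemannSum-affine _⁻¹ (x - 1ℚ) n 0ℚ 1ℚ)

-- log x = ∫₁ˣ dt/t.  Since 1 ≤ x, replacing seq x n by its maximum with 1 does
-- not change the limit.
log : (x : ℝ) → 1ℝ ≤ℝ x → ℝ
log x _ = mkℝ ℓ prf
  where
  ℓ : ℕ → ℚ
  ℓ n = logApprox n (seq x n ⊔ 1ℚ)
  prf : ∀ ε → 0ℚ < ε → ∃ λ N → ∀ m n → N ℕ.≤ m → N ℕ.≤ n → ∣ ℓ m - ℓ n ∣ ≤ ε
  prf ε 0<ε =
    let B , 0≤B , L , f = bounded x
        M , g = archimedes ((B ⊔ 1ℚ) + 1ℚ) (0<half 0<ε)
        N , h = cauchy x (½ * ε) (0<half 0<ε)
        K = L ℕ.⊔ (M ℕ.⊔ N)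
        go : ∀ m n → K ℕ.≤ m → K ℕ.≤ n → ℓ m - ℓ n ≤ ε
        go m n m≥ n≥ =
          let MN≤m = ℕ.m⊔n≤o⇒n≤o L (M ℕ.⊔ N) m≥
              MN≤n = ℕ.m⊔n≤o⇒n≤o L (M ℕ.⊔ N) n≥
              p = seq x m ⊔ 1ℚ
              q = seq x n ⊔ 1ℚ
              1≤q = p≤q⊔p (seq x n) 1ℚ
              step₁ : ℓ m ≤ logApprox m q + ½ * ε
              step₁ = ≤-trans (logApprox-lip m p q (p≤q⊔p (seq x m) 1ℚ) 1≤q)
                (+-monoʳ-≤ (logApprox m q) (≤-trans (⊔-lip (seq x m) (seq x n) 1ℚ)
                  (h m n (ℕ.m⊔n≤o⇒n≤o M N MN≤m) (ℕ.m⊔n≤o⇒n≤o M N MN≤n))))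
              step₂ : logApprox m q ≤ ℓ n + ½ * ε
              step₂ = ≤-trans
                (logApprox-refine M m n q 1≤q (ℕ.m⊔n≤o⇒m≤o M N MN≤m) (ℕ.m⊔n≤o⇒m≤o M N MN≤n))
                (+-monoʳ-≤ (ℓ n) (≤-trans
                  (*-monoˡ-≤-nonNeg (half^ M) {{nonNegative (0≤half^ M)}} (+-monoˡ-≤ 1ℚ
                    (⊔-mono-≤ (≤-trans (p≤∣p∣ (seq x n)) (f n (ℕ.m⊔n≤o⇒m≤o L _ n≥))) (≤-refl {1ℚ}))))
                  (g M ℕ.≤-refl)))
          in ≤+⇒-≤ (ℓ m) (ℓ n) (≤-trans step₁ (≤-trans (+-monoˡ-≤ (½ * ε) step₂)
               (≤-reflexive (solve 2 (λ l e → l :+ con ½ :* e :+ con ½ :* e := l :+ e) refl (ℓ n) ε))))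
    in K , λ m n m≥ n≥ → ∣∣≤ (ℓ m) (ℓ n) (go m n m≥ n≥) (go n m n≥ m≥)

fromℕ : ℕ → ℚ
fromℕ n = + n / 1

-- For non-negative terms f i, the (possibly infinite) sum of f i over all i
-- satisfying P is the supremum of the sums over finite sets of such i.
SumBoundedBy : {I : Set} (P : I → Set) (f : I → ℚ) → ℝ → Set
SumBoundedBy {I} P f B =
  (is : List I) → Unique is → All P is → fromℚ (foldr _+_ 0ℚ (map f is)) ≤ℝ B

record Index : Set where
  constructor index
  field
    r₁ r₂ d₁ d₂ : ℕ

  lcmᵢ : ℕ
  lcmᵢ = lcm (r₁ ℕ.^ 2 ℕ.* d₁) (r₂ ℕ.^ 2 ℕ.* d₂)

record Admissible (Δ : ℤ) (X : ℝ) (i : Index) : Set where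
  open Index i
  field
    r₁≥1 : 1 ℕ.≤ r₁
    r₂≥1 : 1 ℕ.≤ r₂
    d₁≥1 : 1 ℕ.≤ d₁
    d₂≥1 : 1 ℕ.≤ d₂
    r₁⊥Δ : ℤ.gcd (+ r₁) Δ ≡ 1ℤ
    r₂⊥Δ : ℤ.gcd (+ r₂) Δ ≡ 1ℤ
    primes∣d₁ : ∀ q → Prime q → q ℕ.∣ d₁ → + q ℤ.∣ Δ
    primes∣d₂ : ∀ q → Prime q → q ℕ.∣ d₂ → + q ℤ.∣ Δ
    X≤lcm : X ≤ℝ fromℚ (fromℕ lcmᵢ)

term : Index → ℚ
term i = fromℕ (Index.lcmᵢ i) ⁻¹

{-# OPTIONS --safe #-}

-- Write r₁ = g a and r₂ = g b with g = (r₁ , r₂), and D = [d₁ , d₂].  Since r₁ r₂ is prime to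
-- d₁ d₂, the least common multiple is (g a b)² D.  Put g, a, b in dyadic blocks
-- [2ⁱ , 2ⁱ⁺¹), [2ʲ , 2ʲ⁺¹), [2ᵏ , 2ᵏ⁺¹) and D in [4ᴶ , 4ᴶ⁺¹): a term is at most 4^-(i+j+k+J),
-- and if 4ᴷ ≤ X then i + j + k + J + 3 ≥ K.  A block of g, a, b has 2^(i+j+k) elements, so for
-- given d₁, d₂ the sum is at most 4^-J times a twofold convolution tail of 2^-i, that is
-- O(K² 2^-K 2^-J).  Finally D² ≥ d₁ d₂ gives 2^-J ≤ 2^-(j₁+j₂) when 16^j₁ ≤ d₁ and 16^j₂ ≤ d₂, and
-- the sum of 2^-j₁ over all d₁ whose prime factors are at most |Δ| is bounded by a product of
-- |Δ| geometric series.
module Submission where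

open import Data.Empty using (⊥)
open import Data.List.Base using (List; []; _∷_; _++_; map; foldr; concatMap; upTo; applyUpTo; cartesianProductWith; cartesianProduct)
open import Data.List.Membership.Propositional using (_∈_)
open import Data.List.Membership.Propositional.Properties using (∈-++⁻; ∈-++⁺ˡ; ∈-++⁺ʳ; ∈-∃++; ∈-map⁺; ∈-concatMap⁺; ∈-upTo⁺; ∈-cartesianProductWith⁺; ∈-cartesianProduct⁺)
open import Data.List.Relation.Unary.All as All using (All; []; _∷_)
open import Data.List.Relation.Unary.AllPairs using ([]; _∷_)
open import Data.List.Relation.Unary.Any as Any using (here; there)
open import Data.List.Relation.Unary.Unique.Propositional using (Unique)
open import Data.Nat.Coprimality as Coprimality using (Coprime; coprime-divisor; coprime-/gcd)
open import Data.Nat.GCD using (gcd; gcd-greatest; gcd[m,n]∣m; gcd[m,n]∣n; gcd[m,n]≢0; m/gcd[m,n]≢0; n/gcd[m,n]≢0)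
open import Data.Nat.LCM using (lcm; lcm-least; m∣lcm[m,n]; n∣lcm[m,n])
open import Data.Nat.Primality using (Prime; euclidsLemma; prime[2]; prime⇒nonTrivial)
open import Data.Product using (∃; _×_; _,_; proj₁; proj₂)
open import Data.Sum using (inj₁; inj₂)
open import Function.Base using (id; _∘_)
open import Relation.Binary.PropositionalEquality using (_≡_; _≢_; refl; sym; trans; cong; cong₂; subst; subst₂; module ≡-Reasoning)
open import Relation.Nullary using (yes; no; contradiction; ¬_)
open import Relation.Unary using (Decidable)

module Arithmetic where

  open import Data.Nat.Base
  open import Data.Nat.Divisibility
  open import Data.Nat.DivMod using (m*[n/m]≡n)
  open import Data.Nat.Primality.Factorisation using (factorise)
  open import Data.Nat.Properties
  open import Data.Nat.Solver using (module +-*-Solver)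

  open +-*-Solver using (solve; _:=_; _:+_; _:*_; con)

  -- Integer logarithms and dyadic blocks.

  greatest : {P : ℕ → Set} → Decidable P → ℕ → ℕ
  greatest P? zero = zero
  greatest P? (suc n) with P? (suc n)
  ... | yes _ = suc n
  ... | no  _ = greatest P? n

  -- The search runs downwards, so the successor of its result is either a candidate already
  -- rejected or `suc n`. The hypothesis `P 0` covers the default value 0.
  greatest-spec : {P : ℕ → Set} (P? : Decidable P) (n : ℕ) → P 0 → ¬ P (suc n) →
    P (greatest P? n) × ¬ P (suc (greatest P? n))
  greatest-spec P? zero p0 ¬p = p0 , ¬p
  greatest-spec P? (suc n) p0 ¬p with P? (suc n)
  ... | yes p = p , ¬p
  ... | no ¬q = greatest-spec P? n p0 ¬q

  n<b^n : ∀ b → 2 ≤ b → ∀ n → n < b ^ n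
  n<b^n b 2≤b zero    = z<s
  n<b^n b 2≤b (suc n) = begin-strict
    suc n           ≤⟨ n<b^n b 2≤b n ⟩
    b ^ n           <⟨ m<m+n (b ^ n) (≤-trans z<s (n<b^n b 2≤b n)) ⟩
    b ^ n + b ^ n   ≡⟨ cong (b ^ n +_) (sym (+-identityʳ (b ^ n))) ⟩
    2 * b ^ n       ≤⟨ *-monoˡ-≤ (b ^ n) 2≤b ⟩
    b ^ suc n       ∎
    where open ≤-Reasoning

  -- Searching the exponents up to `n` is enough, because `n < b ^ n` for `b ≥ 2`.
  floorLog : ℕ → ℕ → ℕ
  floorLog b n = greatest (λ k → b ^ k ≤? n) n

  floorLog-spec : ∀ b n → 2 ≤ b → 1 ≤ n → b ^ floorLog b n ≤ n × n < b ^ suc (floorLog b n)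
  floorLog-spec b n 2≤b 1≤n =
    let le , ¬le = greatest-spec (λ k → b ^ k ≤? n) n 1≤n (<⇒≱ (<-trans (n<1+n n) (n<b^n b 2≤b (suc n))))
    in le , ≰⇒> ¬le

  -- The pair (i , t) stands for 2ⁱ + t.
  dyadic : ℕ → List (ℕ × ℕ)
  dyadic I = concatMap (λ i → map (i ,_) (upTo (2 ^ i))) (upTo I)

  value : ℕ × ℕ → ℕ
  value (i , t) = 2 ^ i + t

  -- The bound `E` on `n` also bounds its block number, as `i < 2 ^ i ≤ n`. This is crude, but the
  -- sums over blocks are bounded uniformly in the number of blocks.
  ∈-dyadic : ∀ n E → 1 ≤ n → n < E →
    ∃ λ p → p ∈ dyadic E × value p ≡ n × 2 ^ proj₁ p ≤ n × n < 2 ^ suc (proj₁ p)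
  ∈-dyadic n E 1≤n n<E = (i , n ∸ 2 ^ i) ,
    ∈-concatMap⁺ _ (Any.map (λ { refl → ∈-map⁺ _ (∈-upTo⁺ t<) }) (∈-upTo⁺ i<E)) ,
    m+[n∸m]≡n lo , lo , hi
    where
    i  = floorLog 2 n
    lo = proj₁ (floorLog-spec 2 n ≤-refl 1≤n)
    hi = proj₂ (floorLog-spec 2 n ≤-refl 1≤n)
    i<E = <-trans (<-≤-trans (n<b^n 2 ≤-refl i) lo) n<E
    t< : n ∸ 2 ^ i < 2 ^ i
    t< = m<n+o⇒m∸n<o n (2 ^ i) {{m^n≢0 2 i}} (subst (λ k → n < 2 ^ i + k) (+-identityʳ (2 ^ i)) hi)

  -- Coprimality through primes, and the least common multiple.

  primeDivisor : ∀ k → k ≢ 1 → ∃ λ p → Prime p × p ∣ k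
  primeDivisor zero    k≢1 = 2 , prime[2] , 2 ∣0
  primeDivisor (suc k) k≢1 with factorise (suc k)
  ... | record { factors = [] ; isFactorisation = eq } = contradiction eq k≢1
  ... | record { factors = p ∷ ps ; isFactorisation = eq ; factorsPrime = pp ∷ _ } =
    p , pp , subst (p ∣_) (sym eq) (m∣m*n _)

  noCommonPrime⇒coprime : ∀ {m n} → (∀ p → Prime p → p ∣ m → p ∣ n → ⊥) → Coprime m n
  noCommonPrime⇒coprime h {k} (k∣m , k∣n) with k ≟ 1
  ... | yes k≡1 = k≡1
  ... | no  k≢1 = let p , pp , p∣k = primeDivisor k k≢1
                  in contradiction (∣-trans p∣k k∣n) (h p pp (∣-trans p∣k k∣m))

  prime≢1 : ∀ {p} → Prime p → p ≢ 1
  prime≢1 pp refl = contradiction (prime⇒nonTrivial pp) λ ()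

  prime∣^2 : ∀ m {p} → Prime p → p ∣ m ^ 2 → p ∣ m
  prime∣^2 m {p} pp p∣m² with euclidsLemma m m pp (subst (λ k → p ∣ m * k) (*-identityʳ m) p∣m²)
  ... | inj₁ h = h
  ... | inj₂ h = h

  coprime-^2 : ∀ {m n} → Coprime m n → Coprime (m ^ 2) (n ^ 2)
  coprime-^2 {m} {n} cop = noCommonPrime⇒coprime λ p pp p∣m² p∣n² →
    prime≢1 pp (cop (prime∣^2 m pp p∣m² , prime∣^2 n pp p∣n²))

  coprime⇒*∣ : ∀ {m n k} → Coprime m n → m ∣ k → n ∣ k → m * n ∣ k
  coprime⇒*∣ {m} {n} cop (divides-refl q) n∣qm = subst (m * n ∣_) (*-comm m q)
    (*-monoʳ-∣ m (coprime-divisor (Coprimality.sym cop) (subst (n ∣_) (*-comm q m) n∣qm)))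

  ^2-distrib-* : ∀ m n → (m * n) ^ 2 ≡ m ^ 2 * n ^ 2
  ^2-distrib-* = solve 2 (λ m n → m :* n :* (m :* n :* con 1) := m :* (m :* con 1) :* (n :* (n :* con 1))) refl

  ^2-pres-∣ : ∀ {m n} → m ∣ n → m ^ 2 ∣ n ^ 2
  ^2-pres-∣ m∣n = *-pres-∣ m∣n (*-pres-∣ m∣n ∣-refl)

  -- Write `m = q * g ^ 2`. Cancelling `g ^ 2` leaves `a ^ 2` and `b ^ 2` as coprime divisors of
  -- `q`, so their product divides `q`.
  squares∣ : ∀ g a b {m} → 1 ≤ g → Coprime a b → (g * a) ^ 2 ∣ m → (g * b) ^ 2 ∣ m → (g * a * b) ^ 2 ∣ m
  squares∣ g a b {m} 1≤g cop ga∣m gb∣m with ∣-trans (subst (g ^ 2 ∣_) (sym (^2-distrib-* g a)) (m∣m*n (a ^ 2))) ga∣m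
  ... | divides-refl q = subst₂ _∣_ (sym regroup) (*-comm (g ^ 2) q)
      (*-monoʳ-∣ (g ^ 2) (coprime⇒*∣ (coprime-^2 cop) (cancel a ga∣m) (cancel b gb∣m)))
    where
    instance
      g²≢0 : NonZero (g ^ 2)
      g²≢0 = m^n≢0 g 2 {{>-nonZero 1≤g}}
    cancel : ∀ c → (g * c) ^ 2 ∣ q * g ^ 2 → c ^ 2 ∣ q
    cancel c h = *-cancelˡ-∣ (g ^ 2) (subst₂ _∣_ (^2-distrib-* g c) (*-comm q (g ^ 2)) h)
    regroup : (g * a * b) ^ 2 ≡ g ^ 2 * (a ^ 2 * b ^ 2)
    regroup = trans (cong (_^ 2) (*-assoc g a b)) (trans (^2-distrib-* g (a * b)) (cong (g ^ 2 *_) (^2-distrib-* a b)))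

  -- The right side is a common multiple factor by factor. Conversely, its two factors are coprime
  -- and each divides every common multiple: the first by `squares∣`, the second by the minimality
  -- of `lcm d₁ d₂`.
  lcm-squares : ∀ g a b d₁ d₂ → 1 ≤ g → Coprime a b → Coprime ((g * a * b) ^ 2) (lcm d₁ d₂) →
    lcm ((g * a) ^ 2 * d₁) ((g * b) ^ 2 * d₂) ≡ (g * a * b) ^ 2 * lcm d₁ d₂
  lcm-squares g a b d₁ d₂ 1≤g cop cop′ = ∣-antisym
    (lcm-least (*-pres-∣ (^2-pres-∣ (m∣m*n {g * a} b)) (m∣lcm[m,n] d₁ d₂))
               (*-pres-∣ (^2-pres-∣ gb∣gab) (n∣lcm[m,n] d₁ d₂)))
    (coprime⇒*∣ cop′
      (squares∣ g a b 1≤g cop (∣-trans (m∣m*n d₁) x∣m) (∣-trans (m∣m*n d₂) y∣m))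
      (lcm-least (∣-trans (n∣m*n ((g * a) ^ 2)) x∣m) (∣-trans (n∣m*n ((g * b) ^ 2)) y∣m)))
    where
    x∣m = m∣lcm[m,n] ((g * a) ^ 2 * d₁) ((g * b) ^ 2 * d₂)
    y∣m = n∣lcm[m,n] ((g * a) ^ 2 * d₁) ((g * b) ^ 2 * d₂)
    gb∣gab : g * b ∣ g * a * b
    gb∣gab = *-monoˡ-∣ b (m∣m*n {g} a)

  gcd-split : ∀ r₁ r₂ → 1 ≤ r₁ → 1 ≤ r₂ →
    ∃ λ g → ∃ λ a → ∃ λ b → 1 ≤ g × 1 ≤ a × 1 ≤ b × Coprime a b × g * a ≡ r₁ × g * b ≡ r₂
  gcd-split r₁ r₂ 1≤r₁ 1≤r₂ = g , r₁ / g , r₂ / g , n≢0⇒n>0 (≢-nonZero⁻¹ g) ,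
    n≢0⇒n>0 (m/gcd[m,n]≢0 r₁ r₂) , n≢0⇒n>0 (n/gcd[m,n]≢0 r₁ r₂) ,
    coprime-/gcd r₁ r₂ , m*[n/m]≡n (gcd[m,n]∣m r₁ r₂) , m*[n/m]≡n (gcd[m,n]∣n r₁ r₂)
    where
    g = gcd r₁ r₂
    instance
      r₁≢0 : NonZero r₁
      r₁≢0 = >-nonZero 1≤r₁
      r₂≢0 : NonZero r₂
      r₂≢0 = >-nonZero 1≤r₂
      g≢0 : NonZero g
      g≢0 = ≢-nonZero (gcd[m,n]≢0 r₁ r₂ (inj₁ (≢-nonZero⁻¹ r₁)))

  -- Smooth numbers.

  quot4 : ℕ → ℕ
  quot4 (suc (suc (suc (suc n)))) = suc (quot4 n)
  quot4 _                         = 0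

  -- The pairs (d , j), where d runs over the products of powers qᵉ with e < E of the
  -- numbers 2 ≤ q ≤ n + 1, and j is such that 16ʲ ≤ d.
  smooth : ℕ → ℕ → List (ℕ × ℕ)
  smooth zero    E = (1 , 0) ∷ []
  smooth (suc n) E = cartesianProductWith (λ e dj → (2 + n) ^ e * proj₁ dj , quot4 e + proj₂ dj) (upTo E) (smooth n E)

  -- Any four factors `q ≥ 2` multiply to at least 16.
  16^quot4≤ : ∀ q e → 2 ≤ q → 16 ^ quot4 e ≤ q ^ e
  16^quot4≤ q 0 2≤q = ≤-refl
  16^quot4≤ q 1 2≤q = m^n>0 q {{>-nonZero (<⇒≤ 2≤q)}} 1
  16^quot4≤ q 2 2≤q = m^n>0 q {{>-nonZero (<⇒≤ 2≤q)}} 2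
  16^quot4≤ q 3 2≤q = m^n>0 q {{>-nonZero (<⇒≤ 2≤q)}} 3
  16^quot4≤ q (suc (suc (suc (suc e)))) 2≤q = begin
    16 * 16 ^ quot4 e   ≤⟨ *-mono-≤ (^-monoˡ-≤ 4 2≤q) (16^quot4≤ q e 2≤q) ⟩
    q ^ 4 * q ^ e       ≡⟨ sym (^-distribˡ-+-* q 4 e) ⟩
    q ^ (4 + e)         ∎
    where open ≤-Reasoning

  -- Dividing by `q ≥ 2` lowers `d`, so `fuel = d` is enough; it makes the recursion structural.
  extract : ∀ q fuel d → 2 ≤ q → 1 ≤ d → d ≤ fuel → ∃ λ e → ∃ λ d′ → q ^ e * d′ ≡ d × ¬ q ∣ d′
  extract q zero       d 2≤q 1≤d d≤ = contradiction (≤-trans 1≤d d≤) λ ()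
  extract q (suc fuel) d 2≤q 1≤d d≤ with q ∣? d
  ... | no  q∤d = 0 , d , +-identityʳ d , q∤d
  ... | yes (divides c refl) =
    let 1≤c = n≢0⇒n>0 {c} λ { refl → contradiction 1≤d λ () }
        c<d = <-≤-trans (m<m*n c q {{>-nonZero 1≤c}} 2≤q) ≤-refl
        e , d′ , eq , q∤d′ = extract q fuel c 2≤q 1≤c (s≤s⁻¹ (≤-trans c<d d≤))
    in suc e , d′ , trans (*-assoc q (q ^ e) d′) (trans (cong (q *_) eq) (*-comm q c)) , q∤d′

  ∈-smooth : ∀ n E d → 1 ≤ d → d < E → (∀ p → Prime p → p ∣ d → p < 2 + n) →
    ∃ λ j → (d , j) ∈ smooth n E × 16 ^ j ≤ d
  ∈-smooth zero E d 1≤d d<E h with d ≟ 1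
  ... | yes refl = 0 , here refl , ≤-refl
  ... | no  d≢1  = let p , pp , p∣d = primeDivisor d d≢1 in
    contradiction (nonTrivial⇒n>1 p {{prime⇒nonTrivial pp}}) (<⇒≱ (h p pp p∣d))
  ∈-smooth (suc n) E d 1≤d d<E h with extract (2 + n) d d (s≤s (s≤s z≤n)) 1≤d ≤-refl
  ... | e , d′ , refl , q∤d′ =
    let q = 2 + n
        2≤q = s≤s (s≤s z≤n)
        1≤d′ = n≢0⇒n>0 {d′} λ { refl → q∤d′ (q ∣0) }
        d′≤d = m≤n*m d′ (q ^ e) {{m^n≢0 q e}}
        q^e≤d = m≤m*n (q ^ e) d′ {{>-nonZero 1≤d′}}
        e<E = <-trans (<-≤-trans (n<b^n q 2≤q e) q^e≤d) d<E
        -- A prime factor of `d′` cannot be `q` itself, as `q` no longer divides `d′`; this lowers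
        -- the bound on primes by one.
        j , d′∈ , le = ∈-smooth n E d′ 1≤d′ (≤-<-trans d′≤d d<E) λ p pp p∣d′ →
          ≤∧≢⇒< (s≤s⁻¹ (h p pp (∣n⇒∣m*n (q ^ e) p∣d′))) λ { refl → q∤d′ p∣d′ }
    in quot4 e + j ,
       ∈-cartesianProductWith⁺ (λ e dj → q ^ e * proj₁ dj , quot4 e + proj₂ dj) (∈-upTo⁺ e<E) d′∈ ,
       ≤-trans (≤-reflexive (^-distribˡ-+-* 16 (quot4 e) j)) (*-mono-≤ (16^quot4≤ q e 2≤q) le)

  -- Comparing levels with sizes.

  4^≡ : ∀ n → 4 ^ n ≡ 2 ^ n * 2 ^ n
  4^≡ zero    = refl
  4^≡ (suc n) = trans (cong (4 *_) (4^≡ n))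
    (solve 1 (λ x → con 4 :* (x :* x) := con 2 :* x :* (con 2 :* x)) refl (2 ^ n))

  16^≡ : ∀ n → 16 ^ n ≡ 4 ^ n * 4 ^ n
  16^≡ zero    = refl
  16^≡ (suc n) = trans (cong (16 *_) (16^≡ n))
    (solve 1 (λ x → con 16 :* (x :* x) := con 4 :* x :* (con 4 :* x)) refl (4 ^ n))

  ^-cancel-< : ∀ b {m n} → 2 ≤ b → b ^ m < b ^ n → m < n
  ^-cancel-< b {m} {n} 2≤b lt with m <? n
  ... | yes m<n = m<n
  ... | no  m≮n = contradiction (^-monoʳ-≤ b {{>-nonZero (<⇒≤ 2≤b)}} (≮⇒≥ m≮n)) (<⇒≱ lt)

  -- Multiplying the two hypotheses bounds the square of `4 ^ (j₁ + j₂)` by `D * D`; taking roots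
  -- gives `4 ^ (j₁ + j₂) ≤ D < 4 ^ suc J`.
  levels-add : ∀ {D} j₁ j₂ J → 16 ^ j₁ ≤ D → 16 ^ j₂ ≤ D → D < 4 ^ suc J → j₁ + j₂ ≤ J
  levels-add {D} j₁ j₂ J h₁ h₂ D< = s≤s⁻¹ (^-cancel-< 4 (s≤s (s≤s z≤n)) (≤-<-trans 4^≤D D<))
    where
    sq : 4 ^ (j₁ + j₂) * 4 ^ (j₁ + j₂) ≤ D * D
    sq = begin
      4 ^ (j₁ + j₂) * 4 ^ (j₁ + j₂) ≡⟨ sym (16^≡ (j₁ + j₂)) ⟩
      16 ^ (j₁ + j₂)                ≡⟨ ^-distribˡ-+-* 16 j₁ j₂ ⟩
      16 ^ j₁ * 16 ^ j₂             ≤⟨ *-mono-≤ h₁ h₂ ⟩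
      D * D                         ∎
      where open ≤-Reasoning
    4^≤D : 4 ^ (j₁ + j₂) ≤ D
    4^≤D with 4 ^ (j₁ + j₂) ≤? D
    ... | yes le = le
    ... | no ¬le = contradiction sq (<⇒≱ (*-mono-< (≰⇒> ¬le) (≰⇒> ¬le)))

  -- This is `2 (J + i + j + k)`, written with repeated summands so that the addition law for powers
  -- splits it directly, both for `2 ^_` and for `half^`.
  exponent : ℕ → ℕ → ℕ → ℕ → ℕ
  exponent J i j k = J + J + (i + i + (j + j + (k + k)))

  2^exponent≤ : ∀ {g a b D} J i j k → 2 ^ i ≤ g → 2 ^ j ≤ a → 2 ^ k ≤ b → 4 ^ J ≤ D →
    2 ^ exponent J i j k ≤ (g * a * b) ^ 2 * D
  2^exponent≤ {g} {a} {b} {D} J i j k hg ha hb hD = begin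
    2 ^ exponent J i j k                                          ≡⟨ expand ⟩
    (2 ^ i * 2 ^ j * 2 ^ k) ^ 2 * (2 ^ J * 2 ^ J)                 ≡⟨ cong ((2 ^ i * 2 ^ j * 2 ^ k) ^ 2 *_) (sym (4^≡ J)) ⟩
    (2 ^ i * 2 ^ j * 2 ^ k) ^ 2 * 4 ^ J                           ≤⟨ *-mono-≤ (^-monoˡ-≤ 2 (*-mono-≤ (*-mono-≤ hg ha) hb)) hD ⟩
    (g * a * b) ^ 2 * D                                           ∎
    where
    open ≤-Reasoning
    dbl : ∀ m n → 2 ^ (m + m + n) ≡ 2 ^ m * 2 ^ m * 2 ^ n
    dbl m n = trans (^-distribˡ-+-* 2 (m + m) n) (cong (_* 2 ^ n) (^-distribˡ-+-* 2 m m))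
    expand : 2 ^ exponent J i j k ≡ (2 ^ i * 2 ^ j * 2 ^ k) ^ 2 * (2 ^ J * 2 ^ J)
    expand = trans (dbl J _) (trans (cong (2 ^ J * 2 ^ J *_) (trans (dbl i _) (cong (2 ^ i * 2 ^ i *_)
        (trans (dbl j _) (cong (2 ^ j * 2 ^ j *_) (^-distribˡ-+-* 2 k k))))))
      (solve 4 (λ x y z w → w :* w :* (x :* x :* (y :* y :* (z :* z))) :=
         (x :* y :* z) :* ((x :* y :* z) :* con 1) :* (w :* w)) refl (2 ^ i) (2 ^ j) (2 ^ k) (2 ^ J)))

  -- The upper ends of the four blocks raise the exponent of 4 by four in all; the strict inequality
  -- wins back one, which leaves the 3.
  level≤ : ∀ {g a b D} K J i j k → g < 2 ^ suc i → a < 2 ^ suc j → b < 2 ^ suc k → D < 4 ^ suc J →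
    4 ^ K ≤ (g * a * b) ^ 2 * D → K ≤ 3 + J + i + j + k
  level≤ {g} {a} {b} {D} K J i j k hg ha hb hD le = s≤s⁻¹ (^-cancel-< 4 (s≤s (s≤s z≤n)) (begin-strict
    4 ^ K                                             ≤⟨ le ⟩
    (g * a * b) ^ 2 * D                               <⟨ *-mono-< (^-monoˡ-< 2 (*-mono-< (*-mono-< hg ha) hb)) hD ⟩
    (2 ^ suc i * 2 ^ suc j * 2 ^ suc k) ^ 2 * 4 ^ suc J ≡⟨ cong (_* 4 ^ suc J) (sym (trans (4^≡ (suc i + suc j + suc k)) expand)) ⟩
    4 ^ (suc i + suc j + suc k) * 4 ^ suc J           ≡⟨ sym (^-distribˡ-+-* 4 (suc i + suc j + suc k) (suc J)) ⟩
    4 ^ (suc i + suc j + suc k + suc J)               ≡⟨ cong (4 ^_) (solve 4 (λ i j k J →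
                                                           con 1 :+ i :+ (con 1 :+ j) :+ (con 1 :+ k) :+ (con 1 :+ J) :=
                                                           con 4 :+ J :+ i :+ j :+ k) refl i j k J) ⟩
    4 ^ (4 + J + i + j + k)                           ∎))
    where
    open ≤-Reasoning
    expand : 2 ^ (suc i + suc j + suc k) * 2 ^ (suc i + suc j + suc k) ≡ (2 ^ suc i * 2 ^ suc j * 2 ^ suc k) ^ 2
    expand = trans (cong₂ _*_ eq eq) (cong (x *_) (sym (*-identityʳ x)))
      where
      x = 2 ^ suc i * 2 ^ suc j * 2 ^ suc k
      eq : 2 ^ (suc i + suc j + suc k) ≡ x
      eq = trans (^-distribˡ-+-* 2 (suc i + suc j) (suc k)) (cong (_* 2 ^ suc k) (^-distribˡ-+-* 2 (suc i) (suc j)))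

  ∸³≡0 : ∀ {K} m i j k → K ≤ m + i + j + k → K ∸ m ∸ i ∸ j ∸ k ≡ 0
  ∸³≡0 {K} m i j k le = trans (trans (cong (λ x → x ∸ j ∸ k) (∸-+-assoc K m i))
    (trans (cong (_∸ k) (∸-+-assoc K (m + i) j)) (∸-+-assoc K (m + i + j) k))) (m≤n⇒m∸n≡0 le)

open Arithmetic

open import Defs
open import Data.Integer.Base as ℤ using (ℤ; 0ℤ)
import Data.Integer.Properties as ℤ
open import Data.Nat.Base as ℕ using (ℕ; zero; suc; _∸_)
import Data.Nat.Divisibility as ℕ
import Data.Nat.Properties as ℕ
open import Data.Rational.Base
open import Data.Rational.Properties
open import Data.Rational.Solver using (module +-*-Solver)
import Data.Rational.Unnormalised.Base as ℚᵘ
import Data.Rational.Unnormalised.Properties as ℚᵘ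

open +-*-Solver using (solve; _:=_; _:+_; _:*_; _:-_; con)

-- Finite sums

private variable
  A B C : Set

∑ : (A → ℚ) → List A → ℚ
∑ f xs = foldr _+_ 0ℚ (map f xs)

∑-++ : (f : A → ℚ) (xs ys : List A) → ∑ f (xs ++ ys) ≡ ∑ f xs + ∑ f ys
∑-++ f []       ys = sym (+-identityˡ (∑ f ys))
∑-++ f (x ∷ xs) ys = trans (cong (f x +_) (∑-++ f xs ys)) (sym (+-assoc (f x) (∑ f xs) (∑ f ys)))

∑-map : (f : B → ℚ) (g : A → B) (xs : List A) → ∑ f (map g xs) ≡ ∑ (f ∘ g) xs
∑-map f g []       = refl
∑-map f g (x ∷ xs) = cong (f (g x) +_) (∑-map f g xs)

∑-concatMap : (f : B → ℚ) (g : A → List B) (xs : List A) → ∑ f (concatMap g xs) ≡ ∑ (∑ f ∘ g) xs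
∑-concatMap f g []       = refl
∑-concatMap f g (x ∷ xs) = trans (∑-++ f (g x) (concatMap g xs)) (cong (∑ f (g x) +_) (∑-concatMap f g xs))

∑-cartesianProductWith : (h : C → ℚ) (f : A → B → C) (xs : List A) (ys : List B) →
  ∑ h (cartesianProductWith f xs ys) ≡ ∑ (λ x → ∑ (λ y → h (f x y)) ys) xs
∑-cartesianProductWith h f []       ys = refl
∑-cartesianProductWith h f (x ∷ xs) ys = trans (∑-++ h (map (f x) ys) _)
  (cong₂ _+_ (∑-map h (f x) ys) (∑-cartesianProductWith h f xs ys))

∑-*ˡ : (c : ℚ) (f : A → ℚ) (xs : List A) → ∑ (λ x → c * f x) xs ≡ c * ∑ f xs
∑-*ˡ c f []       = sym (*-zeroʳ c)
∑-*ˡ c f (x ∷ xs) = trans (cong (c * f x +_) (∑-*ˡ c f xs)) (sym (*-distribˡ-+ c (f x) (∑ f xs)))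

∑-cong : {f g : A → ℚ} → (∀ x → f x ≡ g x) → (xs : List A) → ∑ f xs ≡ ∑ g xs
∑-cong h []       = refl
∑-cong h (x ∷ xs) = cong₂ _+_ (h x) (∑-cong h xs)

∑-mono : {f g : A → ℚ} → (∀ x → f x ≤ g x) → (xs : List A) → ∑ f xs ≤ ∑ g xs
∑-mono h []       = ≤-refl
∑-mono h (x ∷ xs) = +-mono-≤ (h x) (∑-mono h xs)

0≤∑ : {f : A → ℚ} → (∀ x → 0ℚ ≤ f x) → (xs : List A) → 0ℚ ≤ ∑ f xs
0≤∑ h []       = ≤-refl
0≤∑ h (x ∷ xs) = 0≤+ (h x) (0≤∑ h xs)

∑-insert : (f : A → ℚ) (x : A) (xs ys : List A) → ∑ f (xs ++ x ∷ ys) ≡ f x + ∑ f (xs ++ ys)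
∑-insert f x xs ys = begin
  ∑ f (xs ++ x ∷ ys)           ≡⟨ ∑-++ f xs (x ∷ ys) ⟩
  ∑ f xs + (f x + ∑ f ys)      ≡⟨ solve 3 (λ a b c → a :+ (b :+ c) := b :+ (a :+ c)) refl (∑ f xs) (f x) (∑ f ys) ⟩
  f x + (∑ f xs + ∑ f ys)      ≡⟨ cong (f x +_) (sym (∑-++ f xs ys)) ⟩
  f x + ∑ f (xs ++ ys)         ∎
  where open ≡-Reasoning

∈-delete : {y z : A} (xs : List A) {ys : List A} → z ∈ xs ++ y ∷ ys → z ≢ y → z ∈ xs ++ ys
∈-delete xs z∈ z≢y with ∈-++⁻ xs z∈
... | inj₁ z∈xs         = ∈-++⁺ˡ z∈xs
... | inj₂ (here z≡y)   = contradiction z≡y z≢y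
... | inj₂ (there z∈ys) = ∈-++⁺ʳ xs z∈ys

-- Distinct x have distinct codes, since a code determines the x it encodes.
∑-encode : {f : A → ℚ} {g : B → ℚ} (decode : B → A) → (∀ y → 0ℚ ≤ g y) →
  (xs : List A) (ys : List B) → Unique xs →
  All (λ x → ∃ λ y → y ∈ ys × decode y ≡ x × f x ≤ g y) xs → ∑ f xs ≤ ∑ g ys
∑-encode decode 0≤g []       ys _ _ = 0≤∑ 0≤g ys
∑-encode {f = f} {g} decode 0≤g (x ∷ xs) ys (x∉xs ∷ xs!) ((y , y∈ys , decode-y , fx≤gy) ∷ codes)
  with as , bs , refl ← ∈-∃++ y∈ys = begin
  f x + ∑ f xs            ≤⟨ +-mono-≤ fx≤gy (∑-encode decode 0≤g xs (as ++ bs) xs! (All.zipWith drop (x∉xs , codes))) ⟩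
  g y + ∑ g (as ++ bs)    ≡⟨ sym (∑-insert g y as bs) ⟩
  ∑ g (as ++ y ∷ bs)      ∎
  where
  open ≤-Reasoning
  drop : ∀ {x′} → x ≢ x′ × (∃ λ z → z ∈ as ++ y ∷ bs × decode z ≡ x′ × f x′ ≤ g z) →
         ∃ λ z → z ∈ as ++ bs × decode z ≡ x′ × f x′ ≤ g z
  drop (x≢x′ , z , z∈ , decode-z , le) =
    z , ∈-delete as z∈ (λ { refl → x≢x′ (trans (sym decode-y) decode-z) }) , decode-z , le

-- Geometric sums and their convolutions.

∑< : ℕ → (ℕ → ℚ) → ℚ
∑< zero    f = 0ℚ
∑< (suc n) f = f 0 + ∑< n (f ∘ suc)

∑-applyUpTo : (f : A → ℚ) (g : ℕ → A) (n : ℕ) → ∑ f (applyUpTo g n) ≡ ∑< n (f ∘ g)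
∑-applyUpTo f g zero    = refl
∑-applyUpTo f g (suc n) = cong (f (g 0) +_) (∑-applyUpTo f (g ∘ suc) n)

∑<-cong : {f g : ℕ → ℚ} (n : ℕ) → (∀ i → f i ≡ g i) → ∑< n f ≡ ∑< n g
∑<-cong zero    h = refl
∑<-cong (suc n) h = cong₂ _+_ (h 0) (∑<-cong n (h ∘ suc))

∑<-mono : {f g : ℕ → ℚ} (n : ℕ) → (∀ i → f i ≤ g i) → ∑< n f ≤ ∑< n g
∑<-mono zero    h = ≤-refl
∑<-mono (suc n) h = +-mono-≤ (h 0) (∑<-mono n (h ∘ suc))

∑<-*ˡ : (c : ℚ) (f : ℕ → ℚ) (n : ℕ) → ∑< n (λ i → c * f i) ≡ c * ∑< n f
∑<-*ˡ c f zero    = sym (*-zeroʳ c)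
∑<-*ˡ c f (suc n) = trans (cong (c * f 0 +_) (∑<-*ˡ c (f ∘ suc) n)) (sym (*-distribˡ-+ c (f 0) (∑< n (f ∘ suc))))

∑<-const : (c : ℚ) (n : ℕ) → ∑< n (λ _ → c) ≡ nat n * c
∑<-const c zero    = sym (*-zeroˡ c)
∑<-const c (suc n) = trans (cong (c +_) (∑<-const c n))
  (solve 2 (λ c k → c :+ k :* c := (con 1ℚ :+ k) :* c) refl c (nat n))

nat-+ : ∀ m n → nat (m ℕ.+ n) ≡ nat m + nat n
nat-+ zero    n = sym (+-identityˡ (nat n))
nat-+ (suc m) n = trans (cong (1ℚ +_) (nat-+ m n)) (sym (+-assoc 1ℚ (nat m) (nat n)))

half^-+ : ∀ m n → half^ (m ℕ.+ n) ≡ half^ m * half^ n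
half^-+ zero    n = sym (*-identityˡ (half^ n))
half^-+ (suc m) n = trans (cong (½ *_) (half^-+ m n)) (sym (*-assoc ½ (half^ m) (half^ n)))

2^*half^ : ∀ n → nat (2 ℕ.^ n) * half^ n ≡ 1ℚ
2^*half^ zero    = refl
2^*half^ (suc n) = begin
  nat (2 ℕ.^ suc n) * (½ * half^ n)
    ≡⟨ cong (λ k → nat (2 ℕ.^ n ℕ.+ k) * (½ * half^ n)) (ℕ.+-identityʳ (2 ℕ.^ n)) ⟩
  nat (2 ℕ.^ n ℕ.+ 2 ℕ.^ n) * (½ * half^ n)       ≡⟨ cong (_* (½ * half^ n)) (nat-+ (2 ℕ.^ n) (2 ℕ.^ n)) ⟩
  (nat (2 ℕ.^ n) + nat (2 ℕ.^ n)) * (½ * half^ n) ≡⟨ solve 2 (λ a h → (a :+ a) :* (con ½ :* h) := a :* h) refl (nat (2 ℕ.^ n)) (half^ n) ⟩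
  nat (2 ℕ.^ n) * half^ n                         ≡⟨ 2^*half^ n ⟩
  1ℚ                                              ∎
  where open ≡-Reasoning

2ℚ : ℚ
2ℚ = 1ℚ + 1ℚ

0≤nat : ∀ n → 0ℚ ≤ nat n
0≤nat zero    = ≤-refl
0≤nat (suc n) = 0≤+ 0≤1 (0≤nat n)

-- After the first term, half of a shorter sum of the same kind remains, and 2 is the fixed point of
-- `s = 1 + s / 2`.
∑<-half^ : ∀ n → ∑< n half^ ≤ 2ℚ
∑<-half^ zero    = nonNegative⁻¹ 2ℚ
∑<-half^ (suc n) = ≤-trans (+-monoʳ-≤ 1ℚ (≤-trans (≤-reflexive (∑<-*ˡ ½ half^ n)) (*-monoˡ-≤-nonNeg ½ (∑<-half^ n)))) ≤-refl

isZero : ℕ → ℚ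
isZero zero    = 1ℚ
isZero (suc _) = 0ℚ

0≤isZero : ∀ n → 0ℚ ≤ isZero n
0≤isZero zero    = 0≤1
0≤isZero (suc n) = ≤-refl

∑<-½ : ∀ n (f : ℕ → ℚ) → ∑< n (λ i → half^ (suc i) * f i) ≡ ½ * ∑< n (λ i → half^ i * f i)
∑<-½ n f = trans (∑<-cong n (λ i → *-assoc ½ (half^ i) (f i))) (∑<-*ˡ ½ (λ i → half^ i * f i) n)

∑<-half^*1 : ∀ n → ∑< n (λ i → half^ i * 1ℚ) ≤ 2ℚ
∑<-half^*1 n = ≤-trans (≤-reflexive (∑<-cong n (λ i → *-identityʳ (half^ i)))) (∑<-half^ n)

-- The terms with `i < L` vanish and the others form a geometric tail. Each induction step drops one
-- vanishing term and takes out a factor `½`.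
∑<-tail : ∀ n L → ∑< n (λ i → half^ i * isZero (L ∸ i)) ≤ 2ℚ * half^ L
∑<-tail n zero = ≤-trans (≤-reflexive (∑<-cong n (λ i → cong (λ k → half^ i * isZero k) (ℕ.0∸n≡0 i)))) (∑<-half^*1 n)
∑<-tail zero (suc L) = 0≤* (nonNegative⁻¹ 2ℚ) (0≤half^ (suc L))
∑<-tail (suc n) (suc L) = begin
  1ℚ * 0ℚ + ∑< n (λ i → half^ (suc i) * isZero (L ∸ i)) ≡⟨ +-identityˡ _ ⟩
  ∑< n (λ i → half^ (suc i) * isZero (L ∸ i))           ≡⟨ ∑<-½ n (λ i → isZero (L ∸ i)) ⟩
  ½ * ∑< n (λ i → half^ i * isZero (L ∸ i))             ≤⟨ *-monoˡ-≤-nonNeg ½ (∑<-tail n L) ⟩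
  ½ * (2ℚ * half^ L)                                    ≡⟨ solve 2 (λ c h → con ½ :* (c :* h) := c :* (con ½ :* h)) refl 2ℚ (half^ L) ⟩
  2ℚ * half^ (suc L)                                    ∎
  where open ≤-Reasoning

-- Each of the terms with `i ≤ L` equals `half^ L`, and there are at most `1 + L` of them; the terms
-- beyond add up to at most one more `half^ L`.
∑<-convolution : ∀ n L → ∑< n (λ i → half^ i * half^ (L ∸ i)) ≤ nat (2 ℕ.+ L) * half^ L
∑<-convolution n zero = ≤-trans (≤-reflexive (∑<-cong n (λ i → cong (λ k → half^ i * half^ k) (ℕ.0∸n≡0 i)))) (∑<-half^*1 n)
∑<-convolution zero (suc L) = 0≤* (0≤nat (3 ℕ.+ L)) (0≤half^ (suc L))
∑<-convolution (suc n) (suc L) = begin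
  1ℚ * half^ (suc L) + ∑< n (λ i → half^ (suc i) * half^ (L ∸ i)) ≡⟨ cong (1ℚ * half^ (suc L) +_) (∑<-½ n (λ i → half^ (L ∸ i))) ⟩
  1ℚ * half^ (suc L) + ½ * ∑< n (λ i → half^ i * half^ (L ∸ i))   ≤⟨ +-monoʳ-≤ (1ℚ * half^ (suc L)) (*-monoˡ-≤-nonNeg ½ (∑<-convolution n L)) ⟩
  1ℚ * half^ (suc L) + ½ * (nat (2 ℕ.+ L) * half^ L)
    ≡⟨ solve 2 (λ k h → con 1ℚ :* (con ½ :* h) :+ con ½ :* (k :* h) := (con 1ℚ :+ k) :* (con ½ :* h)) refl (nat (2 ℕ.+ L)) (half^ L) ⟩
  nat (3 ℕ.+ L) * half^ (suc L)                                   ∎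
  where open ≤-Reasoning

-- The sum of the weights of all codes

nat-mono : ∀ {m n} → m ℕ.≤ n → nat m ≤ nat n
nat-mono {n = n} ℕ.z≤n = 0≤nat n
nat-mono (ℕ.s≤s m≤n)   = +-monoʳ-≤ 1ℚ (nat-mono m≤n)

*-monoˡ : ∀ {p q} r → 0ℚ ≤ r → p ≤ q → r * p ≤ r * q
*-monoˡ r 0≤r p≤q = *-monoˡ-≤-nonNeg r {{nonNegative 0≤r}} p≤q

-- Sums over triples of dyadic blocks.

quarter^ : ℕ → ℚ
quarter^ i = half^ i * half^ i

0≤quarter^ : ∀ i → 0ℚ ≤ quarter^ i
0≤quarter^ i = 0≤* (0≤half^ i) (0≤half^ i)

-- Block `i` has `2 ^ i` elements of weight `quarter^ i` each, which leaves `half^ i`.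
∑-dyadic : (f : ℕ → ℚ) (I : ℕ) →
  ∑ (λ p → quarter^ (proj₁ p) * f (proj₁ p)) (dyadic I) ≡ ∑< I (λ i → half^ i * f i)
∑-dyadic f I = begin
  ∑ F (dyadic I)                                             ≡⟨ ∑-concatMap F (λ i → map (i ,_) (upTo (2 ℕ.^ i))) (upTo I) ⟩
  ∑ (λ i → ∑ F (map (i ,_) (upTo (2 ℕ.^ i)))) (upTo I)       ≡⟨ ∑-applyUpTo _ id I ⟩
  ∑< I (λ i → ∑ F (map (i ,_) (upTo (2 ℕ.^ i))))             ≡⟨ ∑<-cong I block ⟩
  ∑< I (λ i → half^ i * f i)                                 ∎
  where
  open ≡-Reasoning
  F : ℕ × ℕ → ℚ
  F p = quarter^ (proj₁ p) * f (proj₁ p)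
  block : ∀ i → ∑ F (map (i ,_) (upTo (2 ℕ.^ i))) ≡ half^ i * f i
  block i = begin
    ∑ F (map (i ,_) (upTo (2 ℕ.^ i)))            ≡⟨ ∑-map F (i ,_) (upTo (2 ℕ.^ i)) ⟩
    ∑ (λ _ → quarter^ i * f i) (upTo (2 ℕ.^ i))  ≡⟨ ∑-applyUpTo _ id (2 ℕ.^ i) ⟩
    ∑< (2 ℕ.^ i) (λ _ → quarter^ i * f i)        ≡⟨ ∑<-const (quarter^ i * f i) (2 ℕ.^ i) ⟩
    nat (2 ℕ.^ i) * (half^ i * half^ i * f i)    ≡⟨ solve 3 (λ a h v → a :* (h :* h :* v) := a :* h :* (h :* v)) refl (nat (2 ℕ.^ i)) (half^ i) (f i) ⟩
    nat (2 ℕ.^ i) * half^ i * (half^ i * f i)    ≡⟨ cong (_* (half^ i * f i)) (2^*half^ i) ⟩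
    1ℚ * (half^ i * f i)                         ≡⟨ *-identityˡ _ ⟩
    half^ i * f i                                ∎

Triple : Set
Triple = (ℕ × ℕ) × (ℕ × ℕ) × (ℕ × ℕ)

triples : ℕ → List Triple
triples I = cartesianProduct (dyadic I) (cartesianProduct (dyadic I) (dyadic I))

-- isZero (L ∸ i ∸ j ∸ k) is the indicator of L ≤ i + j + k.
tripleWeight : ℕ → Triple → ℚ
tripleWeight L ((i , _) , (j , _) , (k , _)) = quarter^ i * (quarter^ j * (quarter^ k * isZero (L ∸ i ∸ j ∸ k)))

0≤tripleWeight : ∀ L t → 0ℚ ≤ tripleWeight L t
0≤tripleWeight L ((i , _) , (j , _) , (k , _)) =
  0≤* (0≤quarter^ i) (0≤* (0≤quarter^ j) (0≤* (0≤quarter^ k) (0≤isZero (L ∸ i ∸ j ∸ k))))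

-- The truncated subtractions allow summation over one block number at a time: over `k` a geometric
-- tail, then over `j` and over `i` a convolution, each costing a factor of at most `2 + L`.
∑-tripleWeight : ∀ I L → ∑ (tripleWeight L) (triples I) ≤ 2ℚ * (nat (2 ℕ.+ L) * nat (2 ℕ.+ L)) * half^ L
∑-tripleWeight I L = begin
  ∑ (tripleWeight L) (triples I)
    ≡⟨ ∑-cartesianProductWith (tripleWeight L) _,_ (dyadic I) _ ⟩
  ∑ (λ p → ∑ (λ qr → tripleWeight L (p , qr)) pairs) (dyadic I)
    ≡⟨ ∑-cong (λ p → trans (∑-*ˡ (quarter^ (proj₁ p)) (pairWeight (L ∸ proj₁ p)) pairs) (cong (quarter^ (proj₁ p) *_) (double≡ (L ∸ proj₁ p)))) (dyadic I) ⟩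
  ∑ (λ p → quarter^ (proj₁ p) * double (L ∸ proj₁ p)) (dyadic I)
    ≡⟨ ∑-dyadic (λ i → double (L ∸ i)) I ⟩
  ∑< I (λ i → half^ i * double (L ∸ i))
    ≤⟨ ∑<-mono I (λ i → *-monoˡ (half^ i) (0≤half^ i) (≤-trans (double≤ (L ∸ i)) (coarsen i))) ⟩
  ∑< I (λ i → half^ i * (c * half^ (L ∸ i)))
    ≡⟨ pull c L ⟩
  c * ∑< I (λ i → half^ i * half^ (L ∸ i))
    ≤⟨ *-monoˡ c (0≤* 0≤2 (0≤nat (2 ℕ.+ L))) (∑<-convolution I L) ⟩
  2ℚ * nat (2 ℕ.+ L) * (nat (2 ℕ.+ L) * half^ L)
    ≡⟨ solve 3 (λ a k h → a :* k :* (k :* h) := a :* (k :* k) :* h) refl 2ℚ (nat (2 ℕ.+ L)) (half^ L) ⟩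
  2ℚ * (nat (2 ℕ.+ L) * nat (2 ℕ.+ L)) * half^ L ∎
  where
  open ≤-Reasoning
  0≤2 : 0ℚ ≤ 2ℚ
  0≤2 = nonNegative⁻¹ 2ℚ
  c : ℚ
  c = 2ℚ * nat (2 ℕ.+ L)
  single double : ℕ → ℚ
  single M = ∑< I (λ k → half^ k * isZero (M ∸ k))
  double M = ∑< I (λ j → half^ j * single (M ∸ j))
  pull : ∀ c M → ∑< I (λ i → half^ i * (c * half^ (M ∸ i))) ≡ c * ∑< I (λ i → half^ i * half^ (M ∸ i))
  pull c M = trans (∑<-cong I (λ i → solve 3 (λ h c k → h :* (c :* k) := c :* (h :* k)) refl (half^ i) c (half^ (M ∸ i))))
    (∑<-*ˡ c (λ i → half^ i * half^ (M ∸ i)) I)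
  pairs = cartesianProduct (dyadic I) (dyadic I)
  pairWeight : ℕ → (ℕ × ℕ) × (ℕ × ℕ) → ℚ
  pairWeight M ((j , _) , (k , _)) = quarter^ j * (quarter^ k * isZero (M ∸ j ∸ k))
  double≡ : ∀ M → ∑ (pairWeight M) pairs ≡ double M
  double≡ M = trans (∑-cartesianProductWith (pairWeight M) _,_ (dyadic I) (dyadic I)) (trans
    (∑-cong (λ p → trans (∑-*ˡ (quarter^ (proj₁ p)) _ (dyadic I))
                         (cong (quarter^ (proj₁ p) *_) (∑-dyadic (λ k → isZero (M ∸ proj₁ p ∸ k)) I))) (dyadic I))
    (∑-dyadic (λ j → single (M ∸ j)) I))
  double≤ : ∀ M → double M ≤ 2ℚ * nat (2 ℕ.+ M) * half^ M
  double≤ M = begin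
    double M                                           ≤⟨ ∑<-mono I (λ j → *-monoˡ (half^ j) (0≤half^ j) (∑<-tail I (M ∸ j))) ⟩
    ∑< I (λ j → half^ j * (2ℚ * half^ (M ∸ j)))        ≡⟨ pull 2ℚ M ⟩
    2ℚ * ∑< I (λ j → half^ j * half^ (M ∸ j))          ≤⟨ *-monoˡ 2ℚ 0≤2 (∑<-convolution I M) ⟩
    2ℚ * (nat (2 ℕ.+ M) * half^ M)                     ≡⟨ sym (*-assoc 2ℚ (nat (2 ℕ.+ M)) (half^ M)) ⟩
    2ℚ * nat (2 ℕ.+ M) * half^ M                       ∎
  coarsen : ∀ i → 2ℚ * nat (2 ℕ.+ (L ∸ i)) * half^ (L ∸ i) ≤ c * half^ (L ∸ i)
  coarsen i = *-monoʳ-≤-nonNeg (half^ (L ∸ i)) {{nonNegative (0≤half^ (L ∸ i))}}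
    (*-monoˡ 2ℚ 0≤2 (nat-mono (ℕ.+-monoʳ-≤ 2 (ℕ.m∸n≤m L i))))

-- Sums over smooth numbers.

4ℚ 8ℚ : ℚ
4ℚ = 2ℚ + 2ℚ
8ℚ = 4ℚ + 4ℚ

-- In the full series every power of `½` occurs four times, with total 4 · 2 = 8. The induction
-- removes four terms at a time, using 4 + 8 / 2 = 8.
∑<-quot4 : ∀ n → ∑< n (λ e → half^ (quot4 e)) ≤ 8ℚ
∑<-quot4 0 = nonNegative⁻¹ 8ℚ
∑<-quot4 1 = by {r = nat 7} (0≤nat 7) refl
∑<-quot4 2 = by {r = nat 6} (0≤nat 6) refl
∑<-quot4 3 = by {r = nat 5} (0≤nat 5) refl
∑<-quot4 (suc (suc (suc (suc n)))) = begin
  1ℚ + (1ℚ + (1ℚ + (1ℚ + ∑< n (λ e → ½ * half^ (quot4 e))))) ≡⟨ cong (λ s → 1ℚ + (1ℚ + (1ℚ + (1ℚ + s)))) (∑<-*ˡ ½ (half^ ∘ quot4) n) ⟩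
  1ℚ + (1ℚ + (1ℚ + (1ℚ + ½ * ∑< n (half^ ∘ quot4))))
    ≤⟨ +-monoʳ-≤ 1ℚ (+-monoʳ-≤ 1ℚ (+-monoʳ-≤ 1ℚ (+-monoʳ-≤ 1ℚ (*-monoˡ-≤-nonNeg ½ (∑<-quot4 n))))) ⟩
  8ℚ                                                         ∎
  where open ≤-Reasoning

8^ : ℕ → ℚ
8^ zero    = 1ℚ
8^ (suc n) = 8ℚ * 8^ n

0≤8^ : ∀ n → 0ℚ ≤ 8^ n
0≤8^ zero    = 0≤1
0≤8^ (suc n) = 0≤* (nonNegative⁻¹ 8ℚ) (0≤8^ n)

-- A finite Euler product: the weight is multiplicative along the construction of `smooth`, and each
-- base contributes a factor of at most 8.
∑-smooth : ∀ n E → ∑ (half^ ∘ proj₂) (smooth n E) ≤ 8^ n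
∑-smooth zero    E = ≤-refl
∑-smooth (suc n) E = begin
  ∑ (half^ ∘ proj₂) (smooth (suc n) E)
    ≡⟨ ∑-cartesianProductWith (half^ ∘ proj₂) _ (upTo E) (smooth n E) ⟩
  ∑ (λ e → ∑ (λ dj → half^ (quot4 e ℕ.+ proj₂ dj)) (smooth n E)) (upTo E)
    ≡⟨ ∑-cong (λ e → trans (∑-cong (λ dj → half^-+ (quot4 e) (proj₂ dj)) (smooth n E)) (trans
         (∑-*ˡ (half^ (quot4 e)) (half^ ∘ proj₂) (smooth n E)) (*-comm _ s))) (upTo E) ⟩
  ∑ (λ e → s * half^ (quot4 e)) (upTo E)   ≡⟨ ∑-*ˡ s (half^ ∘ quot4) (upTo E) ⟩
  s * ∑ (half^ ∘ quot4) (upTo E)           ≡⟨ cong (s *_) (∑-applyUpTo (half^ ∘ quot4) id E) ⟩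
  s * ∑< E (half^ ∘ quot4)                 ≤⟨ *-monoˡ s (0≤∑ (0≤half^ ∘ proj₂) (smooth n E)) (∑<-quot4 E) ⟩
  s * 8ℚ                                   ≤⟨ *-monoʳ-≤-nonNeg 8ℚ (∑-smooth n E) ⟩
  8^ n * 8ℚ                                ≡⟨ *-comm (8^ n) 8ℚ ⟩
  8^ (suc n)                               ∎
  where
  open ≤-Reasoning
  s = ∑ (half^ ∘ proj₂) (smooth n E)

-- Codes and their weights.

Code : Set
Code = (ℕ × ℕ) × (ℕ × ℕ) × Triple

codes : ℕ → ℕ → List Code
codes n E = cartesianProduct (smooth n E) (cartesianProduct (smooth n E) (triples E))

-- The 8 is the cost of the shift by 3 in `level≤`, and the 2 comes from `∑-tripleWeight`.
levelBound : ℕ → ℚ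
levelBound K = 8ℚ * 2ℚ * (nat (2 ℕ.+ K) * nat (2 ℕ.+ K)) * half^ K

0≤levelBound : ∀ K → 0ℚ ≤ levelBound K
0≤levelBound K = 0≤* (0≤* (nonNegative⁻¹ (8ℚ * 2ℚ)) (0≤* (0≤nat (2 ℕ.+ K)) (0≤nat (2 ℕ.+ K)))) (0≤half^ K)

-- The factor `half^ j` makes up for lowering the threshold from `K` by `j`, since
-- `K ≤ 3 + j + (K ∸ (3 + j))`. Hence the bound is uniform in `j`.
∑-level : ∀ K j I → half^ j * ∑ (tripleWeight (K ∸ (3 ℕ.+ j))) (triples I) ≤ levelBound K
∑-level K j I = begin
  half^ j * ∑ (tripleWeight L) (triples I)     ≤⟨ *-monoˡ (half^ j) (0≤half^ j) (∑-tripleWeight I L) ⟩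
  half^ j * (2ℚ * (nat (2 ℕ.+ L) * nat (2 ℕ.+ L)) * half^ L)
    ≡⟨ solve 3 (λ h k l → h :* (con 2ℚ :* k :* l) := con 8ℚ :* con 2ℚ :* k :* (con ½ :* (con ½ :* (con ½ :* h)) :* l)) refl (half^ j) (nat (2 ℕ.+ L) * nat (2 ℕ.+ L)) (half^ L) ⟩
  8ℚ * 2ℚ * (nat (2 ℕ.+ L) * nat (2 ℕ.+ L)) * (half^ (3 ℕ.+ j) * half^ L)
    ≡⟨ cong (8ℚ * 2ℚ * (nat (2 ℕ.+ L) * nat (2 ℕ.+ L)) *_) (sym (half^-+ (3 ℕ.+ j) L)) ⟩
  8ℚ * 2ℚ * (nat (2 ℕ.+ L) * nat (2 ℕ.+ L)) * half^ (3 ℕ.+ j ℕ.+ L)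
    ≤⟨ *-mono (0≤* (nonNegative⁻¹ (8ℚ * 2ℚ)) (0≤* (0≤nat (2 ℕ.+ L)) (0≤nat (2 ℕ.+ L))))
         (*-monoˡ (8ℚ * 2ℚ) (nonNegative⁻¹ (8ℚ * 2ℚ)) (*-mono (0≤nat (2 ℕ.+ L)) L≤K (0≤nat (2 ℕ.+ L)) L≤K))
         (0≤half^ (3 ℕ.+ j ℕ.+ L)) (half^-anti (ℕ.m≤n+m∸n K (3 ℕ.+ j))) ⟩
  levelBound K ∎
  where
  open ≤-Reasoning
  L = K ∸ (3 ℕ.+ j)
  L≤K = nat-mono (ℕ.+-monoʳ-≤ 2 (ℕ.m∸n≤m K (3 ℕ.+ j)))

module _ (J : ℕ → ℕ → ℕ) (K : ℕ) where

  -- A term carries two factors `half^ J`. One is traded for `half^ j₁ * half^ j₂`, which makes the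
  -- sums over `d₁` and `d₂` converge; the other stays to pay for the lowered threshold in
  -- `∑-level`.
  weight : Code → ℚ
  weight ((d₁ , j₁) , (d₂ , j₂) , t) =
    half^ j₁ * (half^ j₂ * (half^ (J d₁ d₂) * tripleWeight (K ∸ (3 ℕ.+ J d₁ d₂)) t))

  0≤weight : ∀ y → 0ℚ ≤ weight y
  0≤weight ((d₁ , j₁) , (d₂ , j₂) , t) =
    0≤* (0≤half^ j₁) (0≤* (0≤half^ j₂) (0≤* (0≤half^ (J d₁ d₂)) (0≤tripleWeight (K ∸ (3 ℕ.+ J d₁ d₂)) t)))

  -- As `∑-level` is uniform in the level, the coupling of `d₁` and `d₂` through `J` disappears, and
  -- the two smooth sums factor out.
  ∑-weight : ∀ n E → ∑ weight (codes n E) ≤ 8^ n * 8^ n * levelBound K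
  ∑-weight n E = begin
    ∑ weight (codes n E)
      ≡⟨ ∑-cartesianProductWith weight _,_ S _ ⟩
    ∑ (λ a → ∑ (λ y → weight (a , y)) (cartesianProduct S (triples E))) S
      ≡⟨ ∑-cong (λ a → trans (∑-*ˡ (half^ (proj₂ a)) _ (cartesianProduct S (triples E)))
           (cong (half^ (proj₂ a) *_) (trans (∑-cartesianProductWith _ _,_ S (triples E))
             (∑-cong (λ b → trans (∑-*ˡ (half^ (proj₂ b)) _ (triples E))
               (cong (half^ (proj₂ b) *_) (∑-*ˡ (half^ (J (proj₁ a) (proj₁ b))) _ (triples E)))) S)))) S ⟩
    ∑ (λ a → half^ (proj₂ a) * ∑ (λ b → half^ (proj₂ b) * inner (J (proj₁ a) (proj₁ b))) S) S
      ≤⟨ ∑-mono (λ a → *-monoˡ (half^ (proj₂ a)) (0≤half^ (proj₂ a)) (≤-trans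
           (∑-mono (λ b → *-monoˡ (half^ (proj₂ b)) (0≤half^ (proj₂ b)) (∑-level K (J (proj₁ a) (proj₁ b)) E)) S)
           (factor (levelBound K) (0≤levelBound K)))) S ⟩
    ∑ (λ a → half^ (proj₂ a) * (8^ n * levelBound K)) S
      ≤⟨ factor (8^ n * levelBound K) (0≤* (0≤8^ n) (0≤levelBound K)) ⟩
    8^ n * (8^ n * levelBound K)
      ≡⟨ sym (*-assoc (8^ n) (8^ n) (levelBound K)) ⟩
    8^ n * 8^ n * levelBound K ∎
    where
    open ≤-Reasoning
    S = smooth n E
    inner : ℕ → ℚ
    inner j = half^ j * ∑ (tripleWeight (K ∸ (3 ℕ.+ j))) (triples E)
    factor : ∀ c → 0ℚ ≤ c → ∑ (λ a → half^ (proj₂ a) * c) S ≤ 8^ n * c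
    factor c 0≤c = ≤-trans
      (≤-reflexive (trans (∑-cong (λ a → *-comm (half^ (proj₂ a)) c) S) (trans (∑-*ˡ c (half^ ∘ proj₂) S) (*-comm c _))))
      (*-monoʳ-≤-nonNeg c {{nonNegative 0≤c}} (∑-smooth n E))

-- Encoding the indices

fromℕ≡nat : ∀ n → fromℕ n ≡ nat n
fromℕ≡nat n = toℚᵘ-injective (ℚᵘ.≃-trans (toℚᵘ-fromℚᵘ (ℚᵘ.mkℚᵘ (ℤ.+ n) 0)) (ℚᵘ.≃-sym (toℚᵘ-nat n)))

0<nat2^ : ∀ k → 0ℚ < nat (2 ℕ.^ k)
0<nat2^ k = <-≤-trans 0<1 (nat-mono (ℕ.m^n>0 2 k))

2^⁻¹ : ∀ k → nat (2 ℕ.^ k) ⁻¹ ≡ half^ k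
2^⁻¹ k = begin
  i                      ≡⟨ sym (*-identityʳ i) ⟩
  i * 1ℚ                 ≡⟨ cong (i *_) (sym (2^*half^ k)) ⟩
  i * (x * half^ k)      ≡⟨ solve 3 (λ i x h → i :* (x :* h) := x :* i :* h) refl i x (half^ k) ⟩
  x * i * half^ k        ≡⟨ cong (_* half^ k) (⁻¹-inverse (0<nat2^ k)) ⟩
  1ℚ * half^ k           ≡⟨ *-identityˡ (half^ k) ⟩
  half^ k                ∎
  where
  open ≡-Reasoning
  x = nat (2 ℕ.^ k)
  i = x ⁻¹

2^≤⇒⁻¹≤half^ : ∀ k {m} → 2 ℕ.^ k ℕ.≤ m → fromℕ m ⁻¹ ≤ half^ k
2^≤⇒⁻¹≤half^ k {m} le = subst₂ _≤_ (cong _⁻¹ (sym (fromℕ≡nat m))) (2^⁻¹ k) (⁻¹-anti (0<nat2^ k) (nat-mono le))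

half^-exponent : ∀ J i j k → half^ (exponent J i j k) ≡ half^ J * half^ J * (quarter^ i * (quarter^ j * quarter^ k))
half^-exponent J i j k = trans (dbl J _) (cong (half^ J * half^ J *_) (trans (dbl i _) (cong (quarter^ i *_)
    (trans (dbl j _) (cong (quarter^ j *_) (half^-+ k k))))))
  where
  dbl : ∀ m n → half^ (m ℕ.+ m ℕ.+ n) ≡ half^ m * half^ m * half^ n
  dbl m n = trans (half^-+ (m ℕ.+ m) n) (cong (_* half^ n) (half^-+ m m))

lcmLevel : ℕ → ℕ → ℕ
lcmLevel d₁ d₂ = floorLog 4 (lcm d₁ d₂)

-- Only one of the two factors `half^ J` is weakened, by `j₁ + j₂ ≤ J`. The bound on `K` makes the
-- indicator in `tripleWeight` equal to 1.
half^≤weight : ∀ {K} d₁ d₂ j₁ j₂ i j k t u v → let J = lcmLevel d₁ d₂ in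
  j₁ ℕ.+ j₂ ℕ.≤ J → K ℕ.≤ 3 ℕ.+ J ℕ.+ i ℕ.+ j ℕ.+ k →
  half^ (exponent J i j k) ≤ weight lcmLevel K ((d₁ , j₁) , (d₂ , j₂) , (i , t) , (j , u) , (k , v))
half^≤weight {K} d₁ d₂ j₁ j₂ i j k t u v j≤J K≤ = begin
  half^ (exponent J i j k)                                   ≡⟨ half^-exponent J i j k ⟩
  half^ J * half^ J * q                                      ≡⟨ *-assoc (half^ J) (half^ J) q ⟩
  half^ J * (half^ J * q)                                    ≤⟨ *-monoʳ-≤-nonNeg _ {{nonNegative (0≤* (0≤half^ J) 0≤q)}} (half^-anti j≤J) ⟩
  half^ (j₁ ℕ.+ j₂) * (half^ J * q)                          ≡⟨ cong (_* (half^ J * q)) (half^-+ j₁ j₂) ⟩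
  half^ j₁ * half^ j₂ * (half^ J * q)
    ≡⟨ solve 6 (λ a b h x y z → a :* b :* (h :* (x :* (y :* z))) := a :* (b :* (h :* (x :* (y :* (z :* con 1ℚ)))))) refl
         (half^ j₁) (half^ j₂) (half^ J) (quarter^ i) (quarter^ j) (quarter^ k) ⟩
  half^ j₁ * (half^ j₂ * (half^ J * (quarter^ i * (quarter^ j * (quarter^ k * isZero 0)))))
    ≡⟨ cong (λ z → half^ j₁ * (half^ j₂ * (half^ J * (quarter^ i * (quarter^ j * (quarter^ k * isZero z))))))
         (sym (∸³≡0 (3 ℕ.+ J) i j k K≤)) ⟩
  half^ j₁ * (half^ j₂ * (half^ J * (quarter^ i * (quarter^ j * (quarter^ k * isZero (K ∸ (3 ℕ.+ J) ∸ i ∸ j ∸ k)))))) ∎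
  where
  open ≤-Reasoning
  J = lcmLevel d₁ d₂
  q = quarter^ i * (quarter^ j * quarter^ k)
  0≤q : 0ℚ ≤ q
  0≤q = 0≤* (0≤quarter^ i) (0≤* (0≤quarter^ j) (0≤quarter^ k))

lcm>0 : ∀ m n → 1 ℕ.≤ m → 1 ℕ.≤ n → 1 ℕ.≤ lcm m n
lcm>0 m n 1≤m 1≤n = ℕ.n≢0⇒n>0 λ eq → ℕ.<⇒≢ (ℕ.*-mono-≤ 1≤m 1≤n)
  (sym (ℕ.0∣⇒≡0 (subst (ℕ._∣ m ℕ.* n) eq (lcm-least {m} {n} (ℕ.m∣m*n n) (ℕ.n∣m*n m)))))

-- The three dyadic pairs are the common factor `g` and the cofactors `a` and `b`; the smooth levels
-- matter only for the weight.
decode : Code → Index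
decode ((d₁ , _) , (d₂ , _) , x , y , z) = index (value x ℕ.* value y) (value x ℕ.* value z) d₁ d₂

size : Index → ℕ
size i = (r₁ ℕ.⊔ r₂) ℕ.⊔ (d₁ ℕ.⊔ d₂)
  where open Index i

maxSize : List Index → ℕ
maxSize []       = 0
maxSize (i ∷ is) = size i ℕ.⊔ maxSize is

size≤maxSize : ∀ is → All (λ i → size i ℕ.≤ maxSize is) is
size≤maxSize []       = []
size≤maxSize (i ∷ is) = ℕ.m≤m⊔n (size i) (maxSize is) ∷
  All.map (λ le → ℕ.≤-trans le (ℕ.m≤n⊔m (size i) (maxSize is))) (size≤maxSize is)

module _ (Δ : ℤ) (Δ≢0 : Δ ≢ 0ℤ) where

  private
    n = ℤ.∣ Δ ∣
    instance
      n≢0 : ℕ.NonZero n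
      n≢0 = ℕ.≢-nonZero (Δ≢0 ∘ ℤ.∣i∣≡0⇒i≡0)

  -- The code consists of the dyadic positions of `g`, `a`, `b` from `gcd-split` and of the smooth
  -- representations of `d₁`, `d₂`. By `lcm-squares` the block bounds become bounds for the least
  -- common multiple, hence for the term.
  encode : ∀ {X i} K E → Admissible Δ X i → 4 ℕ.^ K ℕ.≤ Index.lcmᵢ i → size i ℕ.< E →
    ∃ λ y → y ∈ codes n E × decode y ≡ i × term i ≤ weight lcmLevel K y
  encode {X} {index r₁ r₂ d₁ d₂} K E adm 4^K≤ size<E
    with g , a , b , 1≤g , 1≤a , 1≤b , cop , refl , refl ← gcd-split r₁ r₂ (Admissible.r₁≥1 adm) (Admissible.r₂≥1 adm)
    with p@(i , t) , p∈ , refl , g≥ , g< ← ∈-dyadic g E 1≤g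
           (ℕ.≤-<-trans (ℕ.≤-trans (ℕ.m≤m*n g a {{ℕ.>-nonZero 1≤a}}) (ℕ.≤-trans (ℕ.m≤m⊔n r₁ r₂) (ℕ.m≤m⊔n _ _))) size<E)
    with q@(j , u) , q∈ , refl , a≥ , a< ← ∈-dyadic a E 1≤a
           (ℕ.≤-<-trans (ℕ.≤-trans (ℕ.m≤n*m a g {{ℕ.>-nonZero 1≤g}}) (ℕ.≤-trans (ℕ.m≤m⊔n r₁ r₂) (ℕ.m≤m⊔n _ _))) size<E)
    with r@(k , v) , r∈ , refl , b≥ , b< ← ∈-dyadic b E 1≤b
           (ℕ.≤-<-trans (ℕ.≤-trans (ℕ.m≤n*m b g {{ℕ.>-nonZero 1≤g}}) (ℕ.≤-trans (ℕ.m≤n⊔m r₁ r₂) (ℕ.m≤m⊔n _ _))) size<E)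
    with j₁ , d₁∈ , d₁≥ ← ∈-smooth n E d₁ (Admissible.d₁≥1 adm)
           (ℕ.≤-<-trans (ℕ.≤-trans (ℕ.m≤m⊔n d₁ d₂) (ℕ.m≤n⊔m (r₁ ℕ.⊔ r₂) _)) size<E)
           -- A prime dividing the nonzero `Δ` is at most `n`, its absolute value, hence below
           -- `2 + n`.
           (λ s ps s∣d → ℕ.s≤s (ℕ.m≤n⇒m≤1+n (ℕ.∣⇒≤ (Admissible.primes∣d₁ adm s ps s∣d))))
    with j₂ , d₂∈ , d₂≥ ← ∈-smooth n E d₂ (Admissible.d₂≥1 adm)
           (ℕ.≤-<-trans (ℕ.≤-trans (ℕ.m≤n⊔m d₁ d₂) (ℕ.m≤n⊔m (r₁ ℕ.⊔ r₂) _)) size<E)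
           (λ s ps s∣d → ℕ.s≤s (ℕ.m≤n⇒m≤1+n (ℕ.∣⇒≤ (Admissible.primes∣d₂ adm s ps s∣d))))
    = ((d₁ , j₁) , (d₂ , j₂) , p , q , r) ,
      ∈-cartesianProduct⁺ d₁∈ (∈-cartesianProduct⁺ d₂∈ (∈-cartesianProduct⁺ p∈ (∈-cartesianProduct⁺ q∈ r∈))) ,
      refl ,
      ≤-trans (2^≤⇒⁻¹≤half^ (exponent J i j k) (subst (2 ℕ.^ exponent J i j k ℕ.≤_) (sym lcm≡) (2^exponent≤ J i j k g≥ a≥ b≥ D≥)))
              (half^≤weight d₁ d₂ j₁ j₂ i j k t u v
                (levels-add j₁ j₂ J (ℕ.≤-trans d₁≥ (ℕ.∣⇒≤ (m∣lcm[m,n] d₁ d₂))) (ℕ.≤-trans d₂≥ (ℕ.∣⇒≤ (n∣lcm[m,n] d₁ d₂))) D<)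
                (level≤ K J i j k g< a< b< D< (subst (4 ℕ.^ K ℕ.≤_) lcm≡ 4^K≤)))
    where
    open Admissible adm
    D = lcm d₁ d₂
    J = lcmLevel d₁ d₂
    1≤D = lcm>0 d₁ d₂ d₁≥1 d₂≥1
    D≥ = proj₁ (floorLog-spec 4 D (ℕ.s≤s (ℕ.s≤s ℕ.z≤n)) 1≤D)
    D< = proj₂ (floorLog-spec 4 D (ℕ.s≤s (ℕ.s≤s ℕ.z≤n)) 1≤D)
    instance
      D≢0 : ℕ.NonZero D
      D≢0 = ℕ.>-nonZero 1≤D
    prime∣D : ∀ {s} → Prime s → s ℕ.∣ D → s ℕ.∣ n
    prime∣D {s} ps s∣D with euclidsLemma d₁ d₂ ps (ℕ.∣-trans s∣D (lcm-least {d₁} {d₂} (ℕ.m∣m*n d₂) (ℕ.n∣m*n d₁)))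
    ... | inj₁ s∣d₁ = primes∣d₁ s ps s∣d₁
    ... | inj₂ s∣d₂ = primes∣d₂ s ps s∣d₂
    clash : ∀ {s} m → Prime s → s ℕ.∣ m → ℤ.+ gcd m n ≡ ℤ.1ℤ → s ℕ.∣ D → ⊥
    clash m ps s∣m gcd≡1 s∣D = prime≢1 ps (ℕ.∣1⇒≡1 (subst (_ ℕ.∣_) (ℤ.+-injective gcd≡1) (gcd-greatest s∣m (prime∣D ps s∣D))))
    -- A prime dividing `g * a * b` divides `g * a` or `g * b`, which are prime to `Δ`, whereas
    -- every prime dividing `D` divides `Δ`.
    coprime-D : Coprime ((g ℕ.* a ℕ.* b) ℕ.^ 2) D
    coprime-D = noCommonPrime⇒coprime λ s ps s∣R² s∣D → case s ps s∣D (euclidsLemma (g ℕ.* a) b ps (prime∣^2 (g ℕ.* a ℕ.* b) ps s∣R²))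
      where
      case : ∀ s → Prime s → s ℕ.∣ D → _ → ⊥
      case s ps s∣D (inj₁ s∣r₁) = clash (g ℕ.* a) ps s∣r₁ r₁⊥Δ s∣D
      case s ps s∣D (inj₂ s∣b)  = clash (g ℕ.* b) ps (ℕ.∣n⇒∣m*n g s∣b) r₂⊥Δ s∣D
    lcm≡ = lcm-squares g a b d₁ d₂ 1≤g cop coprime-D

  -- The list of codes depends on `is` through `E`, but the bound on its total weight does not.
  ∑-term : ∀ {X} K is → Unique is → All (Admissible Δ X) is → All (λ i → 4 ℕ.^ K ℕ.≤ Index.lcmᵢ i) is →
    ∑ term is ≤ 8^ n * 8^ n * levelBound K
  ∑-term K is is! adm 4^K≤ = ≤-trans
    (∑-encode decode (0≤weight lcmLevel K) is (codes n E) is!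
      (All.zipWith (λ { (a , 4^K≤ , s) → encode K E a 4^K≤ (ℕ.s≤s s) }) (adm , All.zip (4^K≤ , size≤maxSize is))))
    (∑-weight lcmLevel K n E)
    where E = suc (maxSize is)

-- Bounds for log and sqrt

<⇒≱ : ∀ {p q} → p < q → ¬ q ≤ p
<⇒≱ p<q q≤p = <-irrefl refl (<-≤-trans p<q q≤p)

-- The concave piecewise linear function with value j / 2 at 2ʲ for j ≤ m, constant beyond 2ᵐ.
-- It grows by at most (b - a) / a from a to b, so it lies below every left Riemann sum of 1 / t.
ramp : ℕ → ℚ → ℚ
ramp zero    y = 0ℚ
ramp (suc m) y with 2ℚ ≤? y
... | yes _ = ramp m (½ * y) + ½
... | no  _ = ½ * y - ½

ramp-1 : ∀ m → ramp m 1ℚ ≡ 0ℚ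
ramp-1 zero    = refl
ramp-1 (suc m) = refl

nat-2^suc : ∀ m → nat (2 ℕ.^ suc m) ≡ nat (2 ℕ.^ m) + nat (2 ℕ.^ m)
nat-2^suc m = trans (cong (λ k → nat (2 ℕ.^ m ℕ.+ k)) (ℕ.+-identityʳ (2 ℕ.^ m))) (nat-+ (2 ℕ.^ m) (2 ℕ.^ m))

halve-≤ : ∀ {x y} → x + x ≤ y → x ≤ ½ * y
halve-≤ {x} {y} h = ≤-trans (≤-reflexive (solve 1 (λ x → x := con ½ :* (x :+ x)) refl x)) (*-monoˡ-≤-nonNeg ½ h)

ramp-lower : ∀ m y → nat (2 ℕ.^ m) ≤ y → ½ * nat m ≤ ramp m y
ramp-lower zero    y _ = ≤-refl
ramp-lower (suc m) y h with 2ℚ ≤? y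
... | yes _ = ≤-trans (≤-reflexive (solve 1 (λ k → con ½ :* (con 1ℚ :+ k) := con ½ :* k :+ con ½) refl (nat m)))
                (+-monoˡ-≤ ½ (ramp-lower m (½ * y) (halve-≤ (subst (_≤ y) (nat-2^suc m) h))))
... | no 2≰y = contradiction (≤-trans (nat-mono (ℕ.^-monoʳ-≤ 2 {x = 1} {y = suc m} (ℕ.s≤s ℕ.z≤n))) h) 2≰y

0≤tangent : ∀ {a b} → 1ℚ ≤ a → a ≤ b → 0ℚ ≤ (b - a) * a ⁻¹
0≤tangent 1≤a a≤b = 0≤* (≤⇒0≤- a≤b) (0≤⁻¹ (<-≤-trans 0<1 1≤a))

½≤⁻¹ : ∀ {a} → 0ℚ < a → a ≤ 2ℚ → ½ ≤ a ⁻¹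
½≤⁻¹ 0<a a≤2 = ⁻¹-anti 0<a a≤2

½*-⁻¹ : ∀ {a} → 0ℚ < a → (½ * a) ⁻¹ ≡ a ⁻¹ + a ⁻¹
½*-⁻¹ {a} 0<a = begin
  i                        ≡⟨ solve 2 (λ i b → i := i :* con 1ℚ) refl i (a ⁻¹) ⟩
  i * 1ℚ                   ≡⟨ cong (i *_) (sym (⁻¹-inverse 0<a)) ⟩
  i * (a * a ⁻¹)           ≡⟨ solve 3 (λ i a b → i :* (a :* b) := con ½ :* a :* i :* (b :+ b)) refl i a (a ⁻¹) ⟩
  ½ * a * i * (a ⁻¹ + a ⁻¹) ≡⟨ cong (_* (a ⁻¹ + a ⁻¹)) (⁻¹-inverse (0<half 0<a)) ⟩
  1ℚ * (a ⁻¹ + a ⁻¹)       ≡⟨ *-identityˡ _ ⟩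
  a ⁻¹ + a ⁻¹              ∎
  where
  open ≡-Reasoning
  i = (½ * a) ⁻¹

-- The quantity `(b - a) * a ⁻¹` is unchanged when `a` and `b` are both halved, which settles the
-- case where both are at least 2. Below 2 the slope is `½`, and `½ ≤ a ⁻¹` there.
ramp-tangent : ∀ m a b → 1ℚ ≤ a → a ≤ b → ramp m b ≤ ramp m a + (b - a) * a ⁻¹
ramp-tangent zero a b 1≤a a≤b = 0≤+ (≤-refl {0ℚ}) (0≤tangent 1≤a a≤b)
ramp-tangent (suc m) a b 1≤a a≤b with 2ℚ ≤? a | 2ℚ ≤? b
... | yes 2≤a | no 2≰b = contradiction (≤-trans 2≤a a≤b) 2≰b
... | yes 2≤a | yes _ = begin
  ramp m (½ * b) + ½                                          ≤⟨ +-monoˡ-≤ ½ (ramp-tangent m (½ * a) (½ * b) (*-monoˡ-≤-nonNeg ½ 2≤a) (*-monoˡ-≤-nonNeg ½ a≤b)) ⟩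
  ramp m (½ * a) + (½ * b - ½ * a) * (½ * a) ⁻¹ + ½           ≡⟨ cong (λ i → ramp m (½ * a) + (½ * b - ½ * a) * i + ½) (½*-⁻¹ (<-≤-trans 0<1 1≤a)) ⟩
  ramp m (½ * a) + (½ * b - ½ * a) * (a ⁻¹ + a ⁻¹) + ½
    ≡⟨ solve 4 (λ r a b i → r :+ (con ½ :* b :- con ½ :* a) :* (i :+ i) :+ con ½ := r :+ con ½ :+ (b :- a) :* i) refl (ramp m (½ * a)) a b (a ⁻¹) ⟩
  ramp m (½ * a) + ½ + (b - a) * a ⁻¹                         ∎
  where open ≤-Reasoning
-- The inductive tangent at 1, applied to `½ * b`, shows that beyond 2 the ramp stays below the line
-- of slope `½` through its initial segment.
... | no 2≰a | yes 2≤b = begin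
  ramp m (½ * b) + ½                                          ≤⟨ +-monoˡ-≤ ½ (ramp-tangent m 1ℚ (½ * b) ≤-refl (*-monoˡ-≤-nonNeg ½ 2≤b)) ⟩
  ramp m 1ℚ + (½ * b - 1ℚ) * 1ℚ + ½                           ≡⟨ cong (λ r → r + (½ * b - 1ℚ) * 1ℚ + ½) (ramp-1 m) ⟩
  0ℚ + (½ * b - 1ℚ) * 1ℚ + ½
    ≡⟨ solve 2 (λ a b → con 0ℚ :+ (con ½ :* b :- con 1ℚ) :* con 1ℚ :+ con ½ := con ½ :* a :- con ½ :+ (b :- a) :* con ½) refl a b ⟩
  ½ * a - ½ + (b - a) * ½                                     ≤⟨ +-monoʳ-≤ (½ * a - ½) (*-monoˡ (b - a) (≤⇒0≤- a≤b) (½≤⁻¹ (<-≤-trans 0<1 1≤a) (<⇒≤ (≰⇒> 2≰a)))) ⟩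
  ½ * a - ½ + (b - a) * a ⁻¹                                  ∎
  where open ≤-Reasoning
... | no 2≰a | no _ = begin
  ½ * b - ½                                                   ≡⟨ solve 2 (λ a b → con ½ :* b :- con ½ := con ½ :* a :- con ½ :+ (b :- a) :* con ½) refl a b ⟩
  ½ * a - ½ + (b - a) * ½                                     ≤⟨ +-monoʳ-≤ (½ * a - ½) (*-monoˡ (b - a) (≤⇒0≤- a≤b) (½≤⁻¹ (<-≤-trans 0<1 1≤a) (<⇒≤ (≰⇒> 2≰a)))) ⟩
  ½ * a - ½ + (b - a) * a ⁻¹                                  ∎
  where open ≤-Reasoning

ramp≤riemannSum : ∀ m n a b → 1ℚ ≤ a → a ≤ b → ramp m b ≤ ramp m a + riemannSum _⁻¹ n a b
ramp≤riemannSum m zero    a b 1≤a a≤b = ramp-tangent m a b 1≤a a≤b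
ramp≤riemannSum m (suc n) a b 1≤a a≤b = begin
  ramp m b                     ≤⟨ ramp≤riemannSum m n c b (≤-trans 1≤a a≤c) (mid≤hi a b a≤b) ⟩
  ramp m c + s                 ≤⟨ +-monoˡ-≤ s (ramp≤riemannSum m n a c 1≤a a≤c) ⟩
  ramp m a + r + s             ≡⟨ +-assoc (ramp m a) r s ⟩
  ramp m a + (r + s)           ∎
  where
  open ≤-Reasoning
  c = ½ * (a + b)
  a≤c = lo≤mid a b a≤b
  r = riemannSum _⁻¹ n a c
  s = riemannSum _⁻¹ n c b

-- The ramp vanishes at 1 and has risen to `K` at `4 ^ K = 2 ^ (K + K)`.
logApprox-lower : ∀ n K y → 1ℚ ≤ y → nat (4 ℕ.^ K) ≤ y → nat K ≤ logApprox n y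
logApprox-lower n K y 1≤y h = begin
  nat K                                 ≡⟨ solve 1 (λ k → k := con ½ :* (k :+ k)) refl (nat K) ⟩
  ½ * (nat K + nat K)                   ≡⟨ cong (½ *_) (sym (nat-+ K K)) ⟩
  ½ * nat (K ℕ.+ K)                     ≤⟨ ramp-lower (K ℕ.+ K) y (subst (λ k → nat k ≤ y) (trans (4^≡ K) (sym (ℕ.^-distribˡ-+-* 2 K K))) h) ⟩
  ramp (K ℕ.+ K) y                      ≤⟨ ramp≤riemannSum (K ℕ.+ K) n 1ℚ y ≤-refl 1≤y ⟩
  ramp (K ℕ.+ K) 1ℚ + logApprox n y     ≡⟨ cong (_+ logApprox n y) (ramp-1 (K ℕ.+ K)) ⟩
  0ℚ + logApprox n y                    ≡⟨ +-identityˡ (logApprox n y) ⟩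
  logApprox n y                         ∎
  where open ≤-Reasoning

nat-* : ∀ m n → nat (m ℕ.* n) ≡ nat m * nat n
nat-* zero    n = sym (*-zeroˡ (nat n))
nat-* (suc m) n = trans (nat-+ n (m ℕ.* n)) (trans (cong (nat n +_) (nat-* m n))
  (solve 2 (λ n m → n :+ m :* n := (con 1ℚ :+ m) :* n) refl (nat n) (nat m)))

square-cancel-≤ : ∀ {s t} → 0ℚ ≤ t → s * s ≤ t * t → s ≤ t
square-cancel-≤ {s} {t} 0≤t h with s ≤? t
... | yes s≤t = s≤t
... | no  s≰t = contradiction
    (<-≤-trans (≤-<-trans (*-monoˡ t 0≤t (<⇒≤ t<s)) (*-monoˡ-<-pos s {{positive (≤-<-trans 0≤t t<s)}} t<s)) h) (<-irrefl refl)
  where t<s = ≰⇒> s≰t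

-- The absolute value `N` of the numerator bounds `y`, so `y < 4 ^ suc N` ends the search.
floorLog₄ : ∀ y → 1ℚ ≤ y → ∃ λ K → nat (4 ℕ.^ K) ≤ y × y < nat (4 ℕ.^ suc K)
floorLog₄ y 1≤y =
  let N = ℤ.∣ ↥ y ∣
      y< = ≤-<-trans (≤nat y) (<-≤-trans (subst (_< nat (suc N)) (+-identityˡ (nat N)) (+-monoˡ-< (nat N) 0<1))
             (nat-mono (ℕ.<⇒≤ (n<b^n 4 (ℕ.s≤s (ℕ.s≤s ℕ.z≤n)) (suc N)))))
      le , ¬le = greatest-spec (λ k → nat (4 ℕ.^ k) ≤? y) N 1≤y (<⇒≱ y<)
  in greatest (λ k → nat (4 ℕ.^ k) ≤? y) N , le , ≰⇒> ¬le

-- The maximum with 1 is the cutoff that `inverse` applies with the lower bound 1 supplied by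
-- `1≤⇒sqrt-positive`. It is harmless because `2 ^ K ≥ 1`.
half^≤sqrt⁻¹ : ∀ n K x → x < nat (4 ℕ.^ K) → 0ℚ ≤ x → half^ K ≤ (sqrtApprox n x ⊔ 1ℚ) ⁻¹
half^≤sqrt⁻¹ n K x x< 0≤x = subst (_≤ (sqrtApprox n x ⊔ 1ℚ) ⁻¹) (2^⁻¹ K)
  (⁻¹-anti (<-≤-trans 0<1 (p≤q⊔p (sqrtApprox n x) 1ℚ)) (⊔-lub
    (square-cancel-≤ {sqrtApprox n x} (0≤nat (2 ℕ.^ K)) (≤-trans (proj₁ (proj₂ (sqrtApprox-spec n x 0≤x)))
      (≤-trans (<⇒≤ x<) (≤-reflexive (trans (cong nat (4^≡ K)) (nat-* (2 ℕ.^ K) (2 ℕ.^ K)))))))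
    (nat-mono (ℕ.m^n>0 2 K))))

-- From rational approximants of `X` to the final bound.

nat≤+½ : ∀ {m n} → nat m ≤ nat n + ½ → m ℕ.≤ n
nat≤+½ {m} {n} h with m ℕ.≤? n
... | yes m≤n = m≤n
... | no  m≰n = contradiction (≤-trans (≤-trans (≤-reflexive (+-comm (nat n) 1ℚ)) (nat-mono (ℕ.≰⇒> m≰n))) h)
                  (<⇒≱ (+-monoʳ-< (nat n) ½<1))
  where
  ½<1 : ½ < 1ℚ
  ½<1 = subst (_< 1ℚ) (+-identityʳ ½) (+-monoʳ-< ½ 0<½)

eventually : ∀ {I : Set} {P : ℕ → I → Set} (is : List I) →
  All (λ i → ∃ λ N → ∀ n → N ℕ.≤ n → P n i) is → ∃ λ N → ∀ n → N ℕ.≤ n → All (P n) is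
eventually []       []             = 0 , λ _ _ → []
eventually (i ∷ is) ((N , h) ∷ hs) = let M , k = eventually is hs in
  N ℕ.⊔ M , λ n n≥ → h n (ℕ.m⊔n≤o⇒m≤o N M n≥) ∷ k n (ℕ.m⊔n≤o⇒n≤o N M n≥)

160ℚ : ℚ
160ℚ = nat 160

0≤square : ∀ x → 0ℚ ≤ x * x
0≤square x with ≤-total 0ℚ x
... | inj₁ h = 0≤* h h
... | inj₂ h = subst (0ℚ ≤_) (solve 1 (λ x → (con 0ℚ :- x) :* (con 0ℚ :- x) := x :* x) refl x) (0≤* (≤⇒0≤- h) (≤⇒0≤- h))

-- With `k = nat K`, the constant 160 reduces the first step to 16 (k + 2)² ≤ 80 (k² + 1), where the
-- difference of the two sides is the square term 16 (2k - 1)².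
levelBound≤ : ∀ K ℓ v → nat K ≤ ℓ → half^ (suc K) ≤ v → levelBound K ≤ 160ℚ * ((ℓ * ℓ + 1ℚ) * v)
levelBound≤ K ℓ v k≤ℓ h≤v = begin
  levelBound K                                    ≤⟨ by (0≤* (0≤* (nonNegative⁻¹ (8ℚ * 2ℚ)) (0≤square (k + k - 1ℚ))) (0≤half^ K))
      (solve 2 (λ k h → con (8ℚ * 2ℚ) :* ((k :+ k :- con 1ℚ) :* (k :+ k :- con 1ℚ)) :* h :=
        con 160ℚ :* ((k :* k :+ con 1ℚ) :* (con ½ :* h)) :- con 8ℚ :* con 2ℚ :* ((con 1ℚ :+ (con 1ℚ :+ k)) :* (con 1ℚ :+ (con 1ℚ :+ k))) :* h)
        refl k (half^ K)) ⟩
  160ℚ * ((k * k + 1ℚ) * half^ (suc K))           ≤⟨ *-monoˡ 160ℚ (0≤nat 160) (*-mono (0≤+ (0≤* 0≤k 0≤k) 0≤1)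
                                                       (+-monoˡ-≤ 1ℚ (*-mono 0≤k k≤ℓ 0≤k k≤ℓ)) (0≤half^ (suc K)) h≤v) ⟩
  160ℚ * ((ℓ * ℓ + 1ℚ) * v)                       ∎
  where
  open ≤-Reasoning
  k = nat K
  0≤k = 0≤nat K

lemma4p2 : (Δ : ℤ) → Δ ≢ 0ℤ →
    ∃ λ (c : ℝ) → (X : ℝ) (1≤X : 1ℝ ≤ℝ X) →
    SumBoundedBy (Admissible Δ X) term
    (c *ℝ ((log X 1≤X *ℝ log X 1≤X +ℝ 1ℝ) ÷ℝ sqrt X (1≤⇒0≤ X 1≤X) [ 1≤⇒sqrt-positive X 1≤X ]))
lemma4p2 Δ Δ≢0 = fromℚ (c₀ * 160ℚ) , λ X 1≤X is is! adm ε 0<ε →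
  -- Precision `½` is enough: `4 ^ K` and the least common multiples are integers, so `nat≤+½`
  -- recovers the exact inequality. One threshold serves the whole finite list.
  let N , close = eventually is (All.map (λ a → Admissible.X≤lcm a ½ 0<½) adm)
  in N , λ n n≥ →
    let x = seq X n
        y = x ⊔ 1ℚ
        1≤y = p≤q⊔p x 1ℚ
        -- `K` is chosen anew for each approximant of `X`; the constant does not depend on it.
        K , 4^K≤y , y< = floorLog₄ y 1≤y
        ℓ = logApprox n y
        v = (sqrtApprox n (x ⊔ 0ℚ) ⊔ 1ℚ) ⁻¹
        -- The square root is cut off at 0 and the logarithm at 1, hence the comparison of the two
        -- maxima. The upper bound is `4 ^ suc K`, which is why `levelBound≤` takes `half^ (suc K)`.
        x⊔0<4^ = ≤-<-trans (⊔-mono-≤ (≤-refl {x}) 0≤1) y<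
        4^K≤lcm = All.zipWith (λ { {i} (a , h) → nat≤+½ (≤-trans 4^K≤y (⊔-lub
                    (subst (λ q → x ≤ q + ½) (fromℕ≡nat (Index.lcmᵢ i)) h)
                    (≤-trans (nat-mono (lcmᵢ>0 a)) (p≤p+½ (nat (Index.lcmᵢ i)))))) }) (adm , close n n≥)
        S≤ = ≤-trans (∑-term Δ Δ≢0 K is is! adm 4^K≤lcm)
               (≤-trans (*-monoˡ c₀ 0≤c₀ (levelBound≤ K ℓ v (logApprox-lower n K y 1≤y 4^K≤y)
                   (half^≤sqrt⁻¹ n (suc K) (x ⊔ 0ℚ) x⊔0<4^ (p≤q⊔p x 0ℚ))))
                 (≤-reflexive (sym (*-assoc c₀ 160ℚ ((ℓ * ℓ + 1ℚ) * v)))))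
    -- The inequality holds outright for the approximants from `N` on, so `ε` is pure slack.
    in ≤-trans S≤ (by (<⇒≤ 0<ε) (solve 2 (λ a e → e := a :+ e :- a) refl (c₀ * 160ℚ * ((ℓ * ℓ + 1ℚ) * v)) ε))
  where
  -- One Euler product bound for each of the sums over `d₁` and `d₂`.
  c₀ = 8^ ℤ.∣ Δ ∣ * 8^ ℤ.∣ Δ ∣
  0≤c₀ = 0≤* (0≤8^ ℤ.∣ Δ ∣) (0≤8^ ℤ.∣ Δ ∣)
  p≤p+½ : ∀ p → p ≤ p + ½
  p≤p+½ p = by 0≤½ (solve 1 (λ p → con ½ := p :+ con ½ :- p) refl p)
  lcmᵢ>0 : ∀ {X i} → Admissible Δ X i → 1 ℕ.≤ Index.lcmᵢ i
  lcmᵢ>0 {i = index r₁ r₂ d₁ d₂} a = lcm>0 _ _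
      (ℕ.*-mono-≤ (ℕ.m^n>0 r₁ {{ℕ.>-nonZero r₁≥1}} 2) d₁≥1) (ℕ.*-mono-≤ (ℕ.m^n>0 r₂ {{ℕ.>-nonZero r₂≥1}} 2) d₂≥1)
    where open Admissible a
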